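{- Let $n$ be a positive integer and let $A\subseteq\mathbb{Z}_5^n$ satisfy $3A\ne\mathbb{Z}_5^n$. If $|A|>3\cdot 5^{n-1}/2$, then $A$ is contained in a union of two cosets of a subgroup of $\mathbb{Z}_5^n$ of index $5$. Moreover, $$\mathcal{N}_3(\mathbb{Z}_5^n)=\begin{cases}2 & \text{if } n=1,\\ \tfrac12\,(3\cdot 5^{n-1}-1) & \text{if } n\ge 2.\end{cases}$$
   Context: $\mathbb{Z}_5^n$ denotes the elementary abelian group of order $5^n$ (written additively). For a subset $A$ of an abelian group $G$ and a positive integer $k$, $kA:=\{a_1+\dots+a_k\colon a_1,\dots,a_k\in A\}$ is the $k$-fold sumset. The period of $A\subseteq G$ is $\pi(A):=\{g\in G\colon A+g=A\}$; $A$ is aperiodic if $\pi(A)=\{0\}$. For a finite abelian group $G$ and integer $k\ge1$, $\mathcal{N}_k(G)$ is the largest size $|A|$ of a subset $A\subseteq G$ such that $\pi(A)=\{0\}$, $kA\ne G$, and $k(A\cup\{g\})=G$ for every $g\in G\setminus A$ (with the convention $\max\emptyset=0$). -}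

module Defs where

open import Data.Nat using (ℕ; zero; suc; _+_; _*_; _∸_; _^_; _≤_; _<_)
open import Data.Nat.DivMod using (_mod_)
open import Data.Fin using (Fin; toℕ)
open import Data.Fin.Properties using () renaming (_≟_ to _≟F_)
open import Data.Vec using (Vec; []; _∷_; zipWith; replicate)
import Data.Vec.Properties as VP
open import Data.List using (List; []; _∷_; map; concatMap; allFin)
open import Data.Bool using (Bool; true; false; if_then_else_; _∨_)
open import Data.Product using (Σ; _×_; ∃; _,_)
open import Data.Sum using (_⊎_)
open import Relation.Nullary using (¬_; Dec; does)
open import Relation.Binary.PropositionalEquality using (_≡_)

_+₅_ : Fin 5 → Fin 5 → Fin 5
a +₅ b = (toℕ a + toℕ b) mod 5

-₅_ : Fin 5 → Fin 5
-₅ a = (5 ∸ toℕ a) mod 5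

G : ℕ → Set
G n = Vec (Fin 5) n

_⊕_ : ∀ {n} → G n → G n → G n
_⊕_ = zipWith _+₅_

⊖_ : ∀ {n} → G n → G n
⊖ [] = []
⊖ (x ∷ xs) = (-₅ x) ∷ (⊖ xs)

_⊝_ : ∀ {n} → G n → G n → G n
x ⊝ y = x ⊕ (⊖ y)

𝟎 : ∀ {n} → G n
𝟎 = replicate _ Data.Fin.zero

_≟G_ : ∀ {n} (x y : G n) → Dec (x ≡ y)
_≟G_ = VP.≡-dec _≟F_

elems : (n : ℕ) → List (G n)
elems zero = [] ∷ []
elems (suc n) = concatMap (λ x → map (x ∷_) (elems n)) (allFin 5)

Subset : ℕ → Set
Subset n = G n → Bool

_∈_ : ∀ {n} → G n → Subset n → Set
x ∈ A = A x ≡ true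

countL : ∀ {n} → Subset n → List (G n) → ℕ
countL A [] = 0
countL A (x ∷ xs) = (if A x then 1 else 0) + countL A xs

∣_∣ : ∀ {n} → Subset n → ℕ
∣_∣ {n} A = countL A (elems n)

InSumset : ∀ {n} → ℕ → Subset n → G n → Set
InSumset zero A g = g ≡ 𝟎
InSumset (suc zero) A g = g ∈ A
InSumset (suc (suc k)) A g = Σ (G _) λ a → a ∈ A × InSumset (suc k) A (g ⊝ a)

SumsetIsAll : ∀ {n} → ℕ → Subset n → Set
SumsetIsAll {n} k A = (g : G n) → InSumset k A g

_∪｛_｝ : ∀ {n} → Subset n → G n → Subset n
(A ∪｛ g ｝) x = A x ∨ does (x ≟G g)

Aperiodic : ∀ {n} → Subset n → Set
Aperiodic {n} A = (g : G n) → (∀ (x : G n) → A (x ⊝ g) ≡ A x) → g ≡ 𝟎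

record IsSubgroup {n} (H : Subset n) : Set where
  field
    has-zero : 𝟎 ∈ H
    closed-+ : ∀ x y → x ∈ H → y ∈ H → (x ⊕ y) ∈ H
    closed-neg : ∀ x → x ∈ H → (⊖ x) ∈ H

IsIndex5Subgroup : ∀ {n} → Subset n → Set
IsIndex5Subgroup {n} H = IsSubgroup H × (5 * ∣ H ∣ ≡ 5 ^ n)

InTwoCosetsOfIndex5 : ∀ {n} → Subset n → Set
InTwoCosetsOfIndex5 {n} A =
  Σ (Subset n) λ H → IsIndex5Subgroup H ×
    Σ (G n) λ c₁ → Σ (G n) λ c₂ →
      ∀ a → a ∈ A → ((a ⊝ c₁) ∈ H ⊎ (a ⊝ c₂) ∈ H)

Admissible : (k n : ℕ) → Subset n → Set
Admissible k n A =
  Aperiodic A × ¬ SumsetIsAll k A ×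
  (∀ g → A g ≡ false → SumsetIsAll k (A ∪｛ g ｝))

-- m = 𝒩_k(ℤ₅ⁿ): m is the maximum of |A| over admissible A (max ∅ = 0)
IsN : (k n m : ℕ) → Set
IsN k n m =
  (∀ (A : Subset n) → Admissible k n A → ∣ A ∣ ≤ m) ×
  (m ≡ 0 ⊎ Σ (Subset n) λ A → Admissible k n A × ∣ A ∣ ≡ m)

{-# OPTIONS --safe #-}

-- After a translation, 0 ∉ 3A. For a functional φ ≢ 0 let aᵢ be the number of x ∈ A with φ(x) = i, let
-- N = 5ⁿ⁻¹ and S = |A|. Counting the triples and pairs of A by their values under all functionals (a
-- rational substitute for character sums, in which Galois-conjugate characters are grouped together)
-- yields, as 2S > 3N, some φ ≢ 0 with
--   70 Σ_{i+j+k=0} aᵢaⱼaₖ + 45 N Σ aᵢ² < 14 S³ + 9 N S².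
-- For this φ at most two aᵢ are nonzero. Indeed, if i + j + k = 0 and aₖ ≠ 0, then aᵢ + aⱼ ≤ N by
-- pigeonhole, which excludes exactly three nonzero aᵢ; and if aᵢ, aⱼ, aₖ ≠ 0, then
-- aᵢ + aⱼ + aₖ ≤ 6N/5 by a weak form of Kneser's theorem, which together with the former bound makes
-- the displayed inequality fail whenever four or five aᵢ are nonzero.
--
-- A maximal set lying in two layers of φ is their union, hence periodic if n ≥ 2; this bounds 𝒩₃. The bound is
-- attained by ({1} × (F ∖ 0)) ∪ {(2, 0)} ∪ ({4} × P), where F = ℤ₅ⁿ⁻¹ and F ∖ 0 is the disjoint union of P and −P.
module Submission where

open import Defs
open import Data.Bool using (Bool; true; false; if_then_else_; not; _∧_; _∨_)
import Data.Bool.Properties as Bool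
open import Data.Empty using (⊥; ⊥-elim)
open import Data.Fin using (Fin; zero; suc; #_; toℕ)
open import Data.Fin.Properties using (all?; any?) renaming (_≟_ to _≟F_)
open import Data.Integer as ℤ using (0ℤ) renaming (+_ to pos)
import Data.Integer.Properties as ℤ
open import Data.Integer.Solver using (module +-*-Solver)
open import Data.List as List using (List; []; _∷_)
open import Data.Nat using (ℕ; zero; suc; _+_; _*_; _∸_; _^_; _≤_; _<_; _/_; z≤n; s≤s; NonZero; _≤?_)
open import Data.Nat.DivMod using (_mod_; m*n/n≡m)
import Data.Nat.Properties as ℕ
open import Data.Nat.Tactic.RingSolver using (solve-∀)
open import Data.Product using (∃; _×_; _,_; proj₁; proj₂)
open import Data.Sum using (_⊎_; inj₁; inj₂; [_,_]′)
open import Data.Vec using (Vec; []; _∷_; lookup; map; head; tail)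
open import Data.Vec.Properties using (lookup-map)
open import Data.Vec.Relation.Unary.All using (All; []; _∷_)
open import Data.Vec.Relation.Unary.All.Properties using (lookup⁺)
open import Function using (_∘_; mk⇔)
open import Relation.Binary.PropositionalEquality using (_≡_; _≢_; refl; sym; trans; cong; cong₂; subst; subst₂; module ≡-Reasoning)
open import Relation.Nullary using (¬_; Dec; yes; no; does)
open import Relation.Nullary.Decidable using (True; toWitness; map′; ¬?; _×-dec_; _→-dec_; _⊎-dec_; from-yes; decidable-stable; dec-true; dec-false)

-- Certified polynomial inequalities over ℕ

-- Let Â be the Fourier transform of `A`. Over the multiples tφ with t ≠ 0, a fifth of the sum of
-- Â(tφ)³ is the excess of the triple sum over S³/5, and a fifth of the sum of |Â(tφ)|² is the
-- excess of Σ aᵢ² over S²/5; hence 14 = 70/5 and 9 = 45/5. Over all nontrivial characters the cubes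
-- total -S³, but this is spread over many functionals. Parseval's total 5NS - S² for the squares is
-- what shows that, for some φ, the cubes are negative in proportion to the squares. At S = 3N/2 the
-- quotient of the two totals is -9N/14, which fixes the ratio 70 : 45.
--
-- If all five layers are equal, the two sides of the displayed inequality agree. Such points
-- satisfy all the pigeonhole and Kneser bounds, so for five layers there is no margin and the
-- estimate must be exact there; this is the reason for polynomial certificates. The threshold 3N/2
-- is also approached by sets on the layers 1, 2, 4, where the pigeonhole bounds alone are tight;
-- the extremal set comes from this case.

module Certificates where
  open +-*-Solver using (Polynomial; var; con; _:+_; _:*_; _:-_; ⟦_⟧; prove)

  infixl 6 _⊞_
  infixl 7 _⊠_
  infix 4 _≲_
  infix 9 ‵_

  data Expr (m : ℕ) : Set where
    ‵_  : Fin m → Expr m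
    lit : ℕ → Expr m
    _⊞_ : Expr m → Expr m → Expr m
    _⊠_ : Expr m → Expr m → Expr m

  evalℕ : ∀ {m} → Vec ℕ m → Expr m → ℕ
  evalℕ ρ (‵ i)   = lookup ρ i
  evalℕ ρ (lit k) = k
  evalℕ ρ (e ⊞ f) = evalℕ ρ e + evalℕ ρ f
  evalℕ ρ (e ⊠ f) = evalℕ ρ e * evalℕ ρ f

  toPoly : ∀ {m} → Expr m → Polynomial m
  toPoly (‵ i)   = var i
  toPoly (lit k) = con (pos k)
  toPoly (e ⊞ f) = toPoly e :+ toPoly f
  toPoly (e ⊠ f) = toPoly e :* toPoly f

  toPoly-correct : ∀ {m} (ρ : Vec ℕ m) e → pos (evalℕ ρ e) ≡ ⟦ toPoly e ⟧ (map pos ρ)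
  toPoly-correct ρ (‵ i)   = sym (lookup-map i pos ρ)
  toPoly-correct ρ (lit k) = refl
  toPoly-correct ρ (e ⊞ f) = cong₂ ℤ._+_ (toPoly-correct ρ e) (toPoly-correct ρ f)
  toPoly-correct ρ (e ⊠ f) =
    trans (ℤ.pos-* (evalℕ ρ e) (evalℕ ρ f)) (cong₂ ℤ._*_ (toPoly-correct ρ e) (toPoly-correct ρ f))

  Ineq : ℕ → Set
  Ineq m = Expr m × Expr m

  _≲_ : ∀ {m} → Expr m → Expr m → Ineq m
  _≲_ = _,_

  Holds : ∀ {m} → Vec ℕ m → Ineq m → Set
  Holds ρ (l , r) = evalℕ ρ l ≤ evalℕ ρ r

  slack : ∀ {m} → Ineq m → Polynomial m
  slack (l , r) = toPoly r :- toPoly l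

  holds⇒slack≥0 : ∀ {m} (ρ : Vec ℕ m) q → Holds ρ q → 0ℤ ℤ.≤ ⟦ slack q ⟧ (map pos ρ)
  holds⇒slack≥0 ρ (l , r) h =
    ℤ.i≤j⇒0≤j-i (subst₂ ℤ._≤_ (toPoly-correct ρ l) (toPoly-correct ρ r) (ℤ.+≤+ h))

  slack≥0⇒holds : ∀ {m} (ρ : Vec ℕ m) q → 0ℤ ℤ.≤ ⟦ slack q ⟧ (map pos ρ) → Holds ρ q
  slack≥0⇒holds ρ (l , r) h = ℤ.drop‿+≤+
    (subst₂ ℤ._≤_ (sym (toPoly-correct ρ l)) (sym (toPoly-correct ρ r)) (ℤ.0≤i-j⇒j≤i h))

  -- Positivstellensatz certificates: expressions that are nonnegative because they are built by
  -- sums and products from constants, squares and slacks of hypotheses. Only squares may involve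
  -- arbitrary polynomials of unknown sign.
  data Cert (m k : ℕ) : Set where
    lit : ℕ → Cert m k
    hyp : Fin k → Cert m k
    sqr : Polynomial m → Cert m k
    _⊞_ : Cert m k → Cert m k → Cert m k
    _⊠_ : Cert m k → Cert m k → Cert m k

  certPoly : ∀ {m k} → Vec (Ineq m) k → Cert m k → Polynomial m
  certPoly hs (lit n) = con (pos n)
  certPoly hs (hyp i) = slack (lookup hs i)
  certPoly hs (sqr p) = p :* p
  certPoly hs (c ⊞ d) = certPoly hs c :+ certPoly hs d
  certPoly hs (c ⊠ d) = certPoly hs c :* certPoly hs d

  0≤i*j : ∀ {i j} → 0ℤ ℤ.≤ i → 0ℤ ℤ.≤ j → 0ℤ ℤ.≤ i ℤ.* j
  0≤i*j {pos m} {pos n} _ _ = subst (0ℤ ℤ.≤_) (ℤ.pos-* m n) (ℤ.+≤+ z≤n)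

  0≤i*i : ∀ i → 0ℤ ℤ.≤ i ℤ.* i
  0≤i*i i@(pos n)        = 0≤i*j {i} {i} (ℤ.+≤+ z≤n) (ℤ.+≤+ z≤n)
  0≤i*i (ℤ.-[1+ n ]) = ℤ.+≤+ z≤n

  certPoly≥0 : ∀ {m k} (ρ : Vec ℕ m) (hs : Vec (Ineq m) k) → All (Holds ρ) hs →
               ∀ c → 0ℤ ℤ.≤ ⟦ certPoly hs c ⟧ (map pos ρ)
  certPoly≥0 ρ hs ps (lit n) = ℤ.+≤+ z≤n
  certPoly≥0 ρ hs ps (hyp i) = holds⇒slack≥0 ρ (lookup hs i) (lookup⁺ ps i)
  certPoly≥0 ρ hs ps (sqr p) = 0≤i*i (⟦ p ⟧ (map pos ρ))
  certPoly≥0 ρ hs ps (c ⊞ d) = ℤ.+-mono-≤ (certPoly≥0 ρ hs ps c) (certPoly≥0 ρ hs ps d)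
  certPoly≥0 ρ hs ps (c ⊠ d) = 0≤i*j (certPoly≥0 ρ hs ps c) (certPoly≥0 ρ hs ps d)

  -- The certificate equals `K` times the slack of the goal as an integer polynomial. The factor `K`
  -- clears the denominators of rational weights and cancels because it is positive.
  certify : ∀ {m k} (hs : Vec (Ineq m) k) (q : Ineq m) K .{{_ : NonZero K}} (c : Cert m k) →
            (∀ ρ → ⟦ certPoly hs c ⟧ ρ ≡ ⟦ con (pos K) :* slack q ⟧ ρ) →
            ∀ ρ → All (Holds ρ) hs → Holds ρ q
  certify hs q K@(suc _) c eq ρ ps = slack≥0⇒holds ρ q
    (ℤ.*-cancelˡ-≤-pos 0ℤ _ (pos K)
      (subst₂ ℤ._≤_ (sym (ℤ.*-zeroʳ (pos K))) (eq (map pos ρ)) (certPoly≥0 ρ hs ps c)))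

  -- The triples with `i + j + k = 0` in ℤ₅, collected by multiset: 000 once, 014 and 023 in six
  -- orders each, and 113, 221, 334, 442 in three orders each.
  layers³ : (a₀ a₁ a₂ a₃ a₄ : ℕ) → ℕ
  layers³ a₀ a₁ a₂ a₃ a₄ = a₀ * a₀ * a₀ + 6 * (a₀ * (a₁ * a₄ + a₂ * a₃))
    + 3 * (a₁ * a₁ * a₃ + a₂ * a₂ * a₁ + a₃ * a₃ * a₄ + a₄ * a₄ * a₂)

  layers² : (a₀ a₁ a₂ a₃ a₄ : ℕ) → ℕ
  layers² a₀ a₁ a₂ a₃ a₄ = a₀ * a₀ + a₁ * a₁ + a₂ * a₂ + a₃ * a₃ + a₄ * a₄

  Correlated : (N a₀ a₁ a₂ a₃ a₄ : ℕ) → Set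
  Correlated N a₀ a₁ a₂ a₃ a₄ =
    14 * (S * S * S) + 9 * (N * (S * S)) ≤ 70 * layers³ a₀ a₁ a₂ a₃ a₄ + 45 * (N * layers² a₀ a₁ a₂ a₃ a₄)
    where S = a₀ + a₁ + a₂ + a₃ + a₄

  module _ {m : ℕ} where
    private
      κ : ℕ → Polynomial m
      κ k = con (pos k)

    correlated : (N a₀ a₁ a₂ a₃ a₄ : Expr m) → Ineq m
    correlated N a₀ a₁ a₂ a₃ a₄ =
      lit 14 ⊠ (S ⊠ S ⊠ S) ⊞ lit 9 ⊠ (N ⊠ (S ⊠ S)) ≲
      lit 70 ⊠ (a₀ ⊠ a₀ ⊠ a₀ ⊞ lit 6 ⊠ (a₀ ⊠ (a₁ ⊠ a₄ ⊞ a₂ ⊠ a₃))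
                ⊞ lit 3 ⊠ (a₁ ⊠ a₁ ⊠ a₃ ⊞ a₂ ⊠ a₂ ⊠ a₁ ⊞ a₃ ⊠ a₃ ⊠ a₄ ⊞ a₄ ⊠ a₄ ⊠ a₂))
      ⊞ lit 45 ⊠ (N ⊠ (a₀ ⊠ a₀ ⊞ a₁ ⊠ a₁ ⊞ a₂ ⊠ a₂ ⊞ a₃ ⊠ a₃ ⊞ a₄ ⊠ a₄))
      where S = a₀ ⊞ a₁ ⊞ a₂ ⊞ a₃ ⊞ a₄

    half : (N x : Expr m) → Ineq m
    half N x = lit 2 ⊠ x ≲ N

    kneser : (N x y z : Expr m) → Ineq m
    kneser N x y z = lit 5 ⊠ (x ⊞ y ⊞ z) ≲ lit 6 ⊠ N

    -- The weights and squares in the next two certificates were found by linear programming; summing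
    -- over the dilations i ↦ t i of ℤ₅ makes the certificates symmetric.
    small-part : ∀ {j} (a₀ a₁ a₂ a₃ a₄ : Polynomial m) (split l k s : Fin j) → Cert m j
    small-part a₀ a₁ a₂ a₃ a₄ split l k s =
      hyp split ⊠ (lit 90 ⊠ sqr (a₁ :+ κ 2 :* a₃ :- κ 2 :* a₂ :- a₄))
      ⊞ hyp l ⊠ (lit 36 ⊠ sqr (a₁ :+ a₂ :- a₃ :- a₄)
               ⊞ lit 27 ⊠ sqr (κ 2 :* a₀ :- a₁ :- a₄)
               ⊞ lit 9 ⊠ sqr (κ 2 :* a₀ :+ a₄ :- a₁ :- κ 2 :* a₂)
               ⊞ lit 36 ⊠ sqr (κ 2 :* a₁ :+ a₂ :- a₃ :- κ 2 :* a₄))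
      ⊞ hyp k ⊠ (lit 216 ⊠ sqr (κ 2 :* a₀ :+ κ 2 :* a₃ :- κ 2 :* a₁ :- a₂ :- a₄)
               ⊞ lit 72 ⊠ sqr (a₀ :+ κ 2 :* a₃ :- a₁ :- κ 2 :* a₄))
      ⊞ hyp s ⊠ (lit 20 ⊠ sqr (a₁ :+ a₄ :- a₂ :- a₃)
               ⊞ lit 325 ⊠ sqr (a₁ :+ κ 2 :* a₃ :- a₂ :- κ 2 :* a₄)
               ⊞ lit 405 ⊠ sqr (κ 2 :* a₀ :+ κ 2 :* a₃ :- κ 2 :* a₁ :- a₂ :- a₄))

    large-part : ∀ {j} (a₀ a₁ a₂ a₃ a₄ : Polynomial m) (split k s h e : Fin j) → Cert m j
    large-part a₀ a₁ a₂ a₃ a₄ split k s h e =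
      hyp split ⊠ (lit 9005 ⊠ sqr (a₁ :+ a₄ :- a₂ :- a₃) ⊞ lit 1885 ⊠ sqr (κ 2 :* a₀ :- a₁ :- a₄))
      ⊞ hyp k ⊠ (lit 11620 ⊠ sqr (a₀ :- a₄) ⊞ lit 34220 ⊠ sqr (a₁ :+ a₄ :- κ 2 :* a₃))
      ⊞ hyp s ⊠ (lit 46071 ⊠ sqr (a₀ :+ κ 2 :* a₃ :- κ 2 :* a₁ :- a₂)
               ⊞ lit 5782 ⊠ sqr (a₂ :+ a₃ :- κ 2 :* a₄)
               ⊞ lit 30399 ⊠ sqr (a₀ :- a₁))
      ⊞ hyp h ⊠ (lit 45900 ⊠ sqr (κ 2 :* a₀ :+ a₁ :- κ 2 :* a₃ :- a₄)
               ⊞ lit 38200 ⊠ sqr (κ 2 :* a₀ :+ a₁ :- a₂ :- a₃ :- a₄))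
      ⊞ hyp e ⊠ (lit 21220 ⊠ sqr (a₀ :+ a₃ :+ κ 2 :* a₄ :- κ 2 :* a₁ :- κ 2 :* a₂) ⊞ lit 30225 ⊠ sqr (a₂ :- a₃))

  private
    N̂ â₀ â₁ â₂ â₃ â₄ : Expr 6
    N̂  = ‵ # 0
    â₀ = ‵ # 1
    â₁ = ‵ # 2
    â₂ = ‵ # 3
    â₃ = ‵ # 4
    â₄ = ‵ # 5

    v₀ v₁ v₂ v₃ v₄ : Polynomial 6
    v₀ = var (# 1)
    v₁ = var (# 2)
    v₂ = var (# 3)
    v₃ = var (# 4)
    v₄ = var (# 5)

  small-hyps : Vec (Ineq 6) 8
  small-hyps =
    (lit 25 ⊠ â₀ ≲ lit 9 ⊠ N̂) ∷
    (lit 3 ⊠ N̂ ≲ lit 2 ⊠ (â₀ ⊞ â₁ ⊞ â₂ ⊞ â₃ ⊞ â₄)) ∷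
    kneser N̂ â₀ â₁ â₄ ∷ kneser N̂ â₀ â₂ â₃ ∷
    kneser N̂ â₁ â₁ â₃ ∷ kneser N̂ â₂ â₂ â₁ ∷ kneser N̂ â₃ â₃ â₄ ∷ kneser N̂ â₄ â₄ â₂ ∷ []

  large-hyps : Vec (Ineq 6) 11
  large-hyps =
    (lit 9 ⊠ N̂ ≲ lit 25 ⊠ â₀) ∷
    (lit 3 ⊠ N̂ ≲ lit 2 ⊠ (â₀ ⊞ â₁ ⊞ â₂ ⊞ â₃ ⊞ â₄)) ∷
    (lit 5 ⊠ â₀ ≲ lit 2 ⊠ N̂) ∷
    half N̂ â₁ ∷ half N̂ â₂ ∷ half N̂ â₃ ∷ half N̂ â₄ ∷
    kneser N̂ â₁ â₁ â₃ ∷ kneser N̂ â₂ â₂ â₁ ∷ kneser N̂ â₃ â₃ â₄ ∷ kneser N̂ â₄ â₄ â₂ ∷ []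

  -- Since the goal is an equality at points with all `aᵢ` equal, every term of the certificate has
  -- to vanish there. This is why all the squared linear forms, here and in `large-cert`, have
  -- coefficient sum 0.
  small-cert : Cert 6 8
  small-cert =
    small-part v₀ v₁ v₂ v₃ v₄ (# 0) (# 2) (# 4) (# 1) ⊞ small-part v₀ v₂ v₄ v₁ v₃ (# 0) (# 3) (# 5) (# 1) ⊞
    small-part v₀ v₃ v₁ v₄ v₂ (# 0) (# 3) (# 6) (# 1) ⊞ small-part v₀ v₄ v₃ v₂ v₁ (# 0) (# 2) (# 7) (# 1)

  large-cert : Cert 6 11
  large-cert =
    large-part v₀ v₁ v₂ v₃ v₄ (# 0) (# 7) (# 1) (# 3) (# 2) ⊞ large-part v₀ v₂ v₄ v₁ v₃ (# 0) (# 8) (# 1) (# 4) (# 2) ⊞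
    large-part v₀ v₃ v₁ v₄ v₂ (# 0) (# 9) (# 1) (# 5) (# 2) ⊞ large-part v₀ v₄ v₃ v₂ v₁ (# 0) (# 10) (# 1) (# 6) (# 2)

  small-correlated : ∀ ρ → All (Holds ρ) small-hyps → Holds ρ (correlated N̂ â₀ â₁ â₂ â₃ â₄)
  small-correlated = certify small-hyps q 180 small-cert λ ρ → prove ρ (certPoly small-hyps small-cert) (con (pos 180) :* slack q) refl
    where q = correlated N̂ â₀ â₁ â₂ â₃ â₄

  large-correlated : ∀ ρ → All (Holds ρ) large-hyps → Holds ρ (correlated N̂ â₀ â₁ â₂ â₃ â₄)
  large-correlated = certify large-hyps q 16810 large-cert λ ρ → prove ρ (certPoly large-hyps large-cert) (con (pos 16810) :* slack q) refl
    where q = correlated N̂ â₀ â₁ â₂ â₃ â₄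

  module _ {N a₀ a₁ a₂ a₃ a₄ : ℕ} (big : 3 * N ≤ 2 * (a₀ + a₁ + a₂ + a₃ + a₄)) where

    -- The two ranges of `a₀` rest on different hypotheses: below `9 N / 25` the Kneser bounds on
    -- the triples 014 and 023 are used, above it they are replaced by `5 a₀ ≤ 2 N` and the bounds
    -- `2 aᵢ ≤ N`.
    correlated-balanced :
      5 * a₀ ≤ 2 * N → 2 * a₁ ≤ N → 2 * a₂ ≤ N → 2 * a₃ ≤ N → 2 * a₄ ≤ N →
      5 * (a₀ + a₁ + a₄) ≤ 6 * N → 5 * (a₀ + a₂ + a₃) ≤ 6 * N →
      5 * (a₁ + a₁ + a₃) ≤ 6 * N → 5 * (a₂ + a₂ + a₁) ≤ 6 * N →
      5 * (a₃ + a₃ + a₄) ≤ 6 * N → 5 * (a₄ + a₄ + a₂) ≤ 6 * N →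
      Correlated N a₀ a₁ a₂ a₃ a₄
    correlated-balanced e h₁ h₂ h₃ h₄ l₁ l₂ k₁ k₂ k₃ k₄ with ℕ.≤-total (25 * a₀) (9 * N)
    ... | inj₁ small = small-correlated (N ∷ a₀ ∷ a₁ ∷ a₂ ∷ a₃ ∷ a₄ ∷ [])
      (small ∷ big ∷ l₁ ∷ l₂ ∷ k₁ ∷ k₂ ∷ k₃ ∷ k₄ ∷ [])
    ... | inj₂ large = large-correlated (N ∷ a₀ ∷ a₁ ∷ a₂ ∷ a₃ ∷ a₄ ∷ [])
      (large ∷ big ∷ e ∷ h₁ ∷ h₂ ∷ h₃ ∷ h₄ ∷ k₁ ∷ k₂ ∷ k₃ ∷ k₄ ∷ [])

  gap-hyps : Vec (Ineq 5) 6
  gap-hyps =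
    -- Trivially true; its slack makes `N` itself available as a nonnegative factor in the
    -- certificate.
    (lit 0 ≲ N) ∷
    (lit 5 ⊠ a₀ ≲ lit 2 ⊠ N) ∷
    kneser N a₁ a₁ a₃ ∷ kneser N a₀ a₂ a₃ ∷
    (lit 3 ⊠ N ≲ lit 2 ⊠ (a₀ ⊞ a₁ ⊞ a₂ ⊞ a₃ ⊞ lit 0)) ∷
    kneser N a₂ a₂ a₁ ∷ []
    where
    N  = ‵ # 0
    a₀ = ‵ # 1
    a₁ = ‵ # 2
    a₂ = ‵ # 3
    a₃ = ‵ # 4

  -- The slacks p, q, r, s of four of the hypotheses are coordinates centred at the minimum
  -- (2/5, 3/10, 1/5, 3/5) N of the difference of the two sides, all of whose negative terms in these
  -- coordinates are absorbed by the slack u of the last hypothesis.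
  gap-cert : Cert 5 6
  gap-cert =
    u ⊠ (n ⊠ (lit 480 ⊠ p ⊞ lit 750 ⊠ q ⊞ lit 840 ⊠ r ⊞ lit 1290 ⊠ s) ⊞ lit 35 ⊠ p ⊠ p ⊞ lit 70 ⊠ r ⊠ r)
    ⊞ n ⊠ (lit 250 ⊠ n ⊠ n
      ⊞ p ⊠ (lit 635 ⊠ p ⊞ lit 1260 ⊠ q ⊞ lit 1920 ⊠ r ⊞ lit 3420 ⊠ s)
      ⊞ q ⊠ (lit 1350 ⊠ q ⊞ lit 2430 ⊠ r ⊞ lit 5310 ⊠ s)
      ⊞ r ⊠ (lit 1720 ⊠ r ⊞ lit 6810 ⊠ s)
      ⊞ lit 6000 ⊠ s ⊠ s)
    ⊞ p ⊠ p ⊠ (lit 490 ⊠ q ⊞ lit 1155 ⊠ r ⊞ lit 1225 ⊠ s)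
    ⊞ p ⊠ (lit 420 ⊠ q ⊠ q ⊞ lit 1680 ⊠ q ⊠ r ⊞ lit 2100 ⊠ q ⊠ s
      ⊞ lit 1400 ⊠ r ⊠ r ⊞ lit 3780 ⊠ r ⊠ s ⊞ lit 2520 ⊠ s ⊠ s)
    ⊞ q ⊠ q ⊠ (lit 210 ⊠ r ⊞ lit 210 ⊠ s)
    ⊞ q ⊠ (lit 350 ⊠ r ⊠ r ⊞ lit 840 ⊠ r ⊠ s ⊞ lit 630 ⊠ s ⊠ s)
    ⊞ s ⊠ (lit 140 ⊠ r ⊠ r ⊞ lit 420 ⊠ r ⊠ s ⊞ lit 406 ⊠ s ⊠ s)
    where
    n p q r s u : Cert 5 6
    n = hyp (# 0)
    p = lit 2 ⊠ hyp (# 1)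
    q = lit 2 ⊠ hyp (# 2)
    r = lit 2 ⊠ hyp (# 3)
    s = lit 5 ⊠ hyp (# 4)
    u = lit 2 ⊠ hyp (# 5)

  gap-correlated : ∀ ρ → All (Holds ρ) gap-hyps →
    Holds ρ (correlated (‵ # 0) (‵ # 1) (‵ # 2) (‵ # 3) (‵ # 4) (lit 0))
  gap-correlated = certify gap-hyps q 1000 gap-cert λ ρ → prove ρ (certPoly gap-hyps gap-cert) (con (pos 1000) :* slack q) refl
    where q = correlated (‵ # 0) (‵ # 1) (‵ # 2) (‵ # 3) (‵ # 4) (lit 0)

  correlated-gap : ∀ {N a₀ a₁ a₂ a₃} → 3 * N ≤ 2 * (a₀ + a₁ + a₂ + a₃ + 0) →
    5 * a₀ ≤ 2 * N → 5 * (a₁ + a₁ + a₃) ≤ 6 * N → 5 * (a₀ + a₂ + a₃) ≤ 6 * N →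
    5 * (a₂ + a₂ + a₁) ≤ 6 * N → Correlated N a₀ a₁ a₂ a₃ 0
  correlated-gap {N} {a₀} {a₁} {a₂} {a₃} big e k₁ l k₂ =
    gap-correlated (N ∷ a₀ ∷ a₁ ∷ a₂ ∷ a₃ ∷ []) (z≤n ∷ e ∷ k₁ ∷ l ∷ big ∷ k₂ ∷ [])

open Certificates

-- Decision procedures and equational reasoning in ℤ₅ⁿ

allG? : ∀ {n} {P : G n → Set} → (∀ x → Dec (P x)) → Dec (∀ x → P x)
allG? {zero}  P? = map′ (λ p → λ { [] → p }) (λ h → h []) (P? [])
allG? {suc n} P? = map′ (λ h → λ { (i ∷ x) → h i x }) (λ h i x → h (i ∷ x))
  (all? λ i → allG? λ x → P? (i ∷ x))

anyG? : ∀ {n} {P : G n → Set} → (∀ x → Dec (P x)) → Dec (∃ P)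
anyG? {zero}  P? = map′ (λ p → [] , p) (λ { ([] , p) → p }) (P? [])
anyG? {suc n} P? = map′ (λ { (i , x , p) → i ∷ x , p }) (λ { (i ∷ x , p) → i , x , p })
  (any? λ i → anyG? λ x → P? (i ∷ x))

infixl 6 _:+_ _:-_
infix  8 :-_

data Term (k : ℕ) : Set where
  ⟨_⟩  : Fin k → Term k
  :0   : Term k
  _:+_ : Term k → Term k → Term k
  :-_  : Term k → Term k

_:-_ : ∀ {k} → Term k → Term k → Term k
s :- t = s :+ :- t

pattern ′x = ⟨ zero ⟩
pattern ′y = ⟨ suc zero ⟩
pattern ′z = ⟨ suc (suc zero) ⟩
pattern ′w = ⟨ suc (suc (suc zero)) ⟩

eval₅ : ∀ {k} → Vec (Fin 5) k → Term k → Fin 5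
eval₅ ρ ⟨ i ⟩    = lookup ρ i
eval₅ ρ :0       = zero
eval₅ ρ (s :+ t) = eval₅ ρ s +₅ eval₅ ρ t
eval₅ ρ (:- t)   = -₅ eval₅ ρ t

evalG : ∀ {k n} → Vec (G n) k → Term k → G n
evalG ρ ⟨ i ⟩    = lookup ρ i
evalG ρ :0       = 𝟎
evalG ρ (s :+ t) = evalG ρ s ⊕ evalG ρ t
evalG ρ (:- t)   = ⊖ evalG ρ t

evalG-∷ : ∀ {k n} (ρ : Vec (G (suc n)) k) t →
          evalG ρ t ≡ eval₅ (map head ρ) t ∷ evalG (map tail ρ) t
evalG-∷ ρ ⟨ i ⟩ = trans (η (lookup ρ i)) (sym (cong₂ _∷_ (lookup-map i head ρ) (lookup-map i tail ρ)))
  where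
  η : ∀ {n} (x : G (suc n)) → x ≡ head x ∷ tail x
  η (_ ∷ _) = refl
evalG-∷ ρ :0 = refl
evalG-∷ ρ (s :+ t) rewrite evalG-∷ ρ s | evalG-∷ ρ t = refl
evalG-∷ ρ (:- t) rewrite evalG-∷ ρ t = refl

Law₅ : ∀ {k} → Term k → Term k → Set
Law₅ {k} s t = (ρ : G k) → eval₅ ρ s ≡ eval₅ ρ t

law₅? : ∀ {k} (s t : Term k) → Dec (Law₅ s t)
law₅? s t = allG? λ ρ → eval₅ ρ s ≟F eval₅ ρ t

-- All operations act coordinatewise, so an identity that holds for every assignment in ℤ₅, a finite
-- check, holds in ℤ₅ⁿ. This also yields identities peculiar to exponent 5.
lift : ∀ {k} {s t : Term k} → Law₅ s t → ∀ {n} (ρ : Vec (G n) k) → evalG ρ s ≡ evalG ρ t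
lift {s = s} {t} h {zero} ρ with evalG ρ s | evalG ρ t
... | [] | [] = refl
lift {s = s} {t} h {suc n} ρ = begin
  evalG ρ s                                       ≡⟨ evalG-∷ ρ s ⟩
  eval₅ (map head ρ) s ∷ evalG (map tail ρ) s     ≡⟨ cong₂ _∷_ (h (map head ρ)) (lift {s = s} {t} h (map tail ρ)) ⟩
  eval₅ (map head ρ) t ∷ evalG (map tail ρ) t     ≡⟨ evalG-∷ ρ t ⟨
  evalG ρ t                                       ∎
  where open ≡-Reasoning

by-law₅ : ∀ {k} (s t : Term k) {_ : True (law₅? s t)} (ρ : Vec (Fin 5) k) → eval₅ ρ s ≡ eval₅ ρ t
by-law₅ s t {h} = toWitness h

by-law : ∀ {k n} (s t : Term k) {_ : True (law₅? s t)} (ρ : Vec (G n) k) → evalG ρ s ≡ evalG ρ t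
by-law s t {h} = lift {s = s} {t} (toWitness h)

-- Summation over ℤ₅ and ℤ₅ⁿ

𝟙 : Bool → ℕ
𝟙 b = if b then 1 else 0

δ₅ : Fin 5 → Fin 5 → ℕ
δ₅ i j = 𝟙 (does (i ≟F j))

δ : ∀ {n} → G n → G n → ℕ
δ x y = 𝟙 (does (x ≟G y))

opaque
  Σ₅ : (Fin 5 → ℕ) → ℕ
  Σ₅ f = f (# 0) + f (# 1) + f (# 2) + f (# 3) + f (# 4)

  ΣG : ∀ {n} → (G n → ℕ) → ℕ
  ΣG {zero}  f = f []
  ΣG {suc n} f = Σ₅ λ i → ΣG λ x → f (i ∷ x)

  Σ₅-cong : ∀ {f g} → (∀ i → f i ≡ g i) → Σ₅ f ≡ Σ₅ g
  Σ₅-cong h = cong₂ _+_ (cong₂ _+_ (cong₂ _+_ (cong₂ _+_ (h _) (h _)) (h _)) (h _)) (h _)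

  Σ₅-mono : ∀ {f g} → (∀ i → f i ≤ g i) → Σ₅ f ≤ Σ₅ g
  Σ₅-mono h = ℕ.+-mono-≤ (ℕ.+-mono-≤ (ℕ.+-mono-≤ (ℕ.+-mono-≤ (h _) (h _)) (h _)) (h _)) (h _)

  Σ₅-+ : ∀ f g → Σ₅ (λ i → f i + g i) ≡ Σ₅ f + Σ₅ g
  Σ₅-+ f g = eq (f (# 0)) (f (# 1)) (f (# 2)) (f (# 3)) (f (# 4)) (g (# 0)) (g (# 1)) (g (# 2)) (g (# 3)) (g (# 4))
    where
    eq : ∀ a b c d e a′ b′ c′ d′ e′ →
         (a + a′) + (b + b′) + (c + c′) + (d + d′) + (e + e′) ≡ (a + b + c + d + e) + (a′ + b′ + c′ + d′ + e′)
    eq = solve-∀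

  Σ₅-*ˡ : ∀ k f → Σ₅ (λ i → k * f i) ≡ k * Σ₅ f
  Σ₅-*ˡ k f = eq k (f (# 0)) (f (# 1)) (f (# 2)) (f (# 3)) (f (# 4))
    where
    eq : ∀ k a b c d e → k * a + k * b + k * c + k * d + k * e ≡ k * (a + b + c + d + e)
    eq = solve-∀

  rotate : ∀ a b c d e → b + c + d + e + a ≡ a + b + c + d + e
  rotate = solve-∀

  Σ₅-shift : ∀ (f : Fin 5 → ℕ) c → Σ₅ (λ i → f (i +₅ c)) ≡ Σ₅ f
  Σ₅-shift f zero = refl
  Σ₅-shift f (suc zero) = rotate (f (# 0)) _ _ _ _
  Σ₅-shift f (suc (suc zero)) = trans (rotate (f (# 1)) _ _ _ _) (rotate (f (# 0)) _ _ _ _)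
  Σ₅-shift f (suc (suc (suc zero))) = sym (trans (rotate (f (# 4)) _ _ _ _) (rotate (f (# 3)) _ _ _ _))
  Σ₅-shift f (suc (suc (suc (suc zero)))) = sym (rotate (f (# 4)) _ _ _ _)

  Σ₅-neg : ∀ (f : Fin 5 → ℕ) → Σ₅ (λ i → f (-₅ i)) ≡ Σ₅ f
  Σ₅-neg f = eq (f (# 0)) (f (# 1)) (f (# 2)) (f (# 3)) (f (# 4))
    where
    eq : ∀ a b c d e → a + e + d + c + b ≡ a + b + c + d + e
    eq = solve-∀

  ΣG-cong : ∀ {n} {f g : G n → ℕ} → (∀ x → f x ≡ g x) → ΣG f ≡ ΣG g
  ΣG-cong {zero}  h = h []
  ΣG-cong {suc n} h = Σ₅-cong λ i → ΣG-cong λ x → h (i ∷ x)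

  ΣG-mono : ∀ {n} {f g : G n → ℕ} → (∀ x → f x ≤ g x) → ΣG f ≤ ΣG g
  ΣG-mono {zero}  h = h []
  ΣG-mono {suc n} h = Σ₅-mono λ i → ΣG-mono λ x → h (i ∷ x)

  ΣG-+ : ∀ {n} (f g : G n → ℕ) → ΣG (λ x → f x + g x) ≡ ΣG f + ΣG g
  ΣG-+ {zero}  f g = refl
  ΣG-+ {suc n} f g = trans (Σ₅-cong λ i → ΣG-+ (f ∘ (i ∷_)) (g ∘ (i ∷_)))
                           (Σ₅-+ (λ i → ΣG (f ∘ (i ∷_))) (λ i → ΣG (g ∘ (i ∷_))))

  ΣG-*ˡ : ∀ {n} k (f : G n → ℕ) → ΣG (λ x → k * f x) ≡ k * ΣG f
  ΣG-*ˡ {zero}  k f = refl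
  ΣG-*ˡ {suc n} k f = trans (Σ₅-cong λ i → ΣG-*ˡ k (f ∘ (i ∷_))) (Σ₅-*ˡ k (λ i → ΣG (f ∘ (i ∷_))))

  ΣG-*ʳ : ∀ {n} (f : G n → ℕ) k → ΣG (λ x → f x * k) ≡ ΣG f * k
  ΣG-*ʳ f k = trans (ΣG-cong λ x → ℕ.*-comm (f x) k) (trans (ΣG-*ˡ k f) (ℕ.*-comm k (ΣG f)))

  ΣG-const : ∀ n k → ΣG {n} (λ _ → k) ≡ 5 ^ n * k
  ΣG-const zero    k = sym (ℕ.+-identityʳ k)
  ΣG-const (suc n) k = trans (Σ₅-cong {g = λ _ → 5 ^ n * k} λ _ → ΣG-const n k) (eq (5 ^ n) k)
    where
    eq : ∀ a k → a * k + a * k + a * k + a * k + a * k ≡ 5 * a * k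
    eq = solve-∀

  ΣG-Σ₅-swap : ∀ {n} (f : G n → Fin 5 → ℕ) → ΣG (λ x → Σ₅ (f x)) ≡ Σ₅ λ i → ΣG λ x → f x i
  ΣG-Σ₅-swap {n} f =
    trans (ΣG-+ (λ x → f x (# 0) + f x (# 1) + f x (# 2) + f x (# 3)) (g (# 4)))
    (cong (_+ ΣG (g (# 4))) (trans (ΣG-+ (λ x → f x (# 0) + f x (# 1) + f x (# 2)) (g (# 3)))
    (cong (_+ ΣG (g (# 3))) (trans (ΣG-+ (λ x → f x (# 0) + f x (# 1)) (g (# 2)))
    (cong (_+ ΣG (g (# 2))) (ΣG-+ (g (# 0)) (g (# 1))))))))
    where
    g : Fin 5 → G n → ℕ
    g i x = f x i

  ΣG-swap : ∀ {m n} (f : G m → G n → ℕ) → ΣG (λ x → ΣG (f x)) ≡ ΣG λ y → ΣG λ x → f x y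
  ΣG-swap {n = zero}  f = refl
  ΣG-swap {n = suc n} f = trans (ΣG-Σ₅-swap (λ x i → ΣG λ y → f x (i ∷ y)))
                                (Σ₅-cong λ i → ΣG-swap (λ x y → f x (i ∷ y)))

  ΣG-shift : ∀ {n} (f : G n → ℕ) c → ΣG (λ x → f (x ⊕ c)) ≡ ΣG f
  ΣG-shift {zero}  f []      = refl
  ΣG-shift {suc n} f (i ∷ c) = trans (Σ₅-cong λ j → ΣG-shift (f ∘ ((j +₅ i) ∷_)) c)
                                     (Σ₅-shift (λ j → ΣG (f ∘ (j ∷_))) i)

  ΣG-neg : ∀ {n} (f : G n → ℕ) → ΣG (λ x → f (⊖ x)) ≡ ΣG f
  ΣG-neg {zero}  f = refl
  ΣG-neg {suc n} f = trans (Σ₅-cong λ j → ΣG-neg (f ∘ ((-₅ j) ∷_))) (Σ₅-neg (λ j → ΣG (f ∘ (j ∷_))))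

  ΣG-0 : ∀ n → ΣG {n} (λ _ → 0) ≡ 0
  ΣG-0 n = trans (ΣG-const n 0) (ℕ.*-zeroʳ (5 ^ n))

  Σ₅-δ : ∀ i (f : Fin 5 → ℕ) → Σ₅ (λ j → δ₅ i j * f j) ≡ f i
  Σ₅-δ zero f = eq (f zero)
    where
    eq : ∀ a → a + 0 + 0 + 0 + 0 + 0 ≡ a
    eq = solve-∀
  Σ₅-δ (suc zero) f = eq (f (# 1))
    where
    eq : ∀ a → a + 0 + 0 + 0 + 0 ≡ a
    eq = solve-∀
  Σ₅-δ (suc (suc zero)) f = eq (f (# 2))
    where
    eq : ∀ a → a + 0 + 0 + 0 ≡ a
    eq = solve-∀
  Σ₅-δ (suc (suc (suc zero))) f = eq (f (# 3))
    where
    eq : ∀ a → a + 0 + 0 ≡ a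
    eq = solve-∀
  Σ₅-δ (suc (suc (suc (suc zero)))) f = ℕ.+-identityʳ _

  δ-∷ : ∀ {n} i j (x y : G n) → δ (i ∷ x) (j ∷ y) ≡ δ₅ i j * δ x y
  δ-∷ i j x y with does (i ≟F j) | does (x ≟G y)
  ... | true  | true  = refl
  ... | true  | false = refl
  ... | false | _     = refl

  ΣG-δ : ∀ {n} x (f : G n → ℕ) → ΣG (λ y → δ x y * f y) ≡ f x
  ΣG-δ []      f = ℕ.+-identityʳ _
  ΣG-δ (i ∷ x) f = begin
    Σ₅ (λ j → ΣG λ y → δ (i ∷ x) (j ∷ y) * f (j ∷ y))   ≡⟨ Σ₅-cong (λ j → ΣG-cong λ y → trans (cong (_* f (j ∷ y)) (δ-∷ i j x y)) (ℕ.*-assoc (δ₅ i j) (δ x y) (f (j ∷ y)))) ⟩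
    Σ₅ (λ j → ΣG λ y → δ₅ i j * (δ x y * f (j ∷ y)))     ≡⟨ Σ₅-cong (λ j → ΣG-*ˡ (δ₅ i j) (λ y → δ x y * f (j ∷ y))) ⟩
    Σ₅ (λ j → δ₅ i j * ΣG λ y → δ x y * f (j ∷ y))       ≡⟨ Σ₅-δ i (λ j → ΣG λ y → δ x y * f (j ∷ y)) ⟩
    ΣG (λ y → δ x y * f (i ∷ y))                          ≡⟨ ΣG-δ x (f ∘ (i ∷_)) ⟩
    f (i ∷ x)                                             ∎
    where open ≡-Reasoning

  countL-++ : ∀ {n} (A : Subset n) xs ys → countL A (xs List.++ ys) ≡ countL A xs + countL A ys
  countL-++ A []       ys = refl
  countL-++ A (x ∷ xs) ys = trans (cong (𝟙 (A x) +_) (countL-++ A xs ys)) (sym (ℕ.+-assoc (𝟙 (A x)) _ _))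

  countL-map : ∀ {m n} (A : Subset n) (f : G m → G n) xs → countL A (List.map f xs) ≡ countL (A ∘ f) xs
  countL-map A f []       = refl
  countL-map A f (x ∷ xs) = cong (𝟙 (A (f x)) +_) (countL-map A f xs)

  ∣∣≡ΣG : ∀ {n} (A : Subset n) → ∣ A ∣ ≡ ΣG (𝟙 ∘ A)
  ∣∣≡ΣG {zero}  A = ℕ.+-identityʳ _
  ∣∣≡ΣG {suc n} A = begin
    countL A (row (# 0) List.++ (row (# 1) List.++ (row (# 2) List.++ (row (# 3) List.++ (row (# 4) List.++ [])))))
      ≡⟨ step (# 0) _ (step (# 1) _ (step (# 2) _ (step (# 3) _ (step (# 4) _ refl)))) ⟩
    s (# 0) + (s (# 1) + (s (# 2) + (s (# 3) + (s (# 4) + 0))))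
      ≡⟨ eq (s (# 0)) _ _ _ _ ⟩
    Σ₅ s ∎
    where
    open ≡-Reasoning
    row : Fin 5 → List (G (suc n))
    row i = List.map (i ∷_) (elems n)
    s : Fin 5 → ℕ
    s i = ΣG (𝟙 ∘ A ∘ (i ∷_))
    step : ∀ i xs {k} → countL A xs ≡ k → countL A (row i List.++ xs) ≡ s i + k
    step i xs h = trans (countL-++ A (row i) xs)
      (cong₂ _+_ (trans (countL-map A (i ∷_) (elems n)) (∣∣≡ΣG (A ∘ (i ∷_)))) h)
    eq : ∀ a b c d e → a + (b + (c + (d + (e + 0)))) ≡ a + b + c + d + e
    eq = solve-∀

  Σ₅-expand : ∀ f → Σ₅ f ≡ f (# 0) + f (# 1) + f (# 2) + f (# 3) + f (# 4)
  Σ₅-expand f = refl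

  ΣG-[] : ∀ (f : G 0 → ℕ) → ΣG f ≡ f []
  ΣG-[] f = refl

  ΣG-∷ : ∀ {n} (f : G (suc n) → ℕ) → ΣG f ≡ Σ₅ λ i → ΣG λ x → f (i ∷ x)
  ΣG-∷ f = refl

-- Linear functionals on ℤ₅ⁿ and their fibres

infixl 7 _*₅_ _·_

_*₅_ : Fin 5 → Fin 5 → Fin 5
a *₅ b = (toℕ a * toℕ b) mod 5

_·_ : ∀ {n} → G n → G n → Fin 5
[]      · []      = zero
(c ∷ φ) · (i ∷ x) = (c *₅ i) +₅ (φ · x)

*₅-comm : ∀ a b → a *₅ b ≡ b *₅ a
*₅-comm = from-yes (all? λ a → all? λ b → a *₅ b ≟F b *₅ a)

*₅-distribˡ-+₅ : ∀ a b c → a *₅ (b +₅ c) ≡ (a *₅ b) +₅ (a *₅ c)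
*₅-distribˡ-+₅ = from-yes (all? λ a → all? λ b → all? λ c → a *₅ (b +₅ c) ≟F (a *₅ b) +₅ (a *₅ c))

*₅-neg : ∀ a b → a *₅ (-₅ b) ≡ -₅ (a *₅ b)
*₅-neg = from-yes (all? λ a → all? λ b → a *₅ (-₅ b) ≟F -₅ (a *₅ b))

·-comm : ∀ {n} (φ x : G n) → φ · x ≡ x · φ
·-comm []      []      = refl
·-comm (c ∷ φ) (i ∷ x) = cong₂ _+₅_ (*₅-comm c i) (·-comm φ x)

·-⊕ : ∀ {n} (φ x y : G n) → φ · (x ⊕ y) ≡ (φ · x) +₅ (φ · y)
·-⊕ []      []      []      = refl
·-⊕ (c ∷ φ) (i ∷ x) (j ∷ y) = trans (cong₂ _+₅_ (*₅-distribˡ-+₅ c i j) (·-⊕ φ x y))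
  (by-law₅ ((′x :+ ′y) :+ (′z :+ ′w)) ((′x :+ ′z) :+ (′y :+ ′w)) (c *₅ i ∷ c *₅ j ∷ φ · x ∷ φ · y ∷ []))

·-⊖ : ∀ {n} (φ x : G n) → φ · (⊖ x) ≡ -₅ (φ · x)
·-⊖ []      []      = refl
·-⊖ (c ∷ φ) (i ∷ x) = trans (cong₂ _+₅_ (*₅-neg c i) (·-⊖ φ x))
  (by-law₅ (:- ′x :- ′y) (:- (′x :+ ′y)) (c *₅ i ∷ φ · x ∷ []))

·-⊝ : ∀ {n} (φ x y : G n) → φ · (x ⊝ y) ≡ (φ · x) +₅ (-₅ (φ · y))
·-⊝ φ x y = trans (·-⊕ φ x (⊖ y)) (cong ((φ · x) +₅_) (·-⊖ φ y))

𝟎· : ∀ {n} (x : G n) → 𝟎 · x ≡ zero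
𝟎· []      = refl
𝟎· (i ∷ x) = cong (zero +₅_) (𝟎· x)

δ₅-+ : ∀ a b c → δ₅ (a +₅ b) c ≡ δ₅ b (c +₅ (-₅ a))
δ₅-+ = from-yes (all? λ a → all? λ b → all? λ c → δ₅ (a +₅ b) c ℕ.≟ δ₅ b (c +₅ (-₅ a)))

δ₅-minus : ∀ a b → δ₅ a b ≡ δ₅ (a +₅ (-₅ b)) zero
δ₅-minus = from-yes (all? λ a → all? λ b → δ₅ a b ℕ.≟ δ₅ (a +₅ (-₅ b)) zero)

opaque
  unfolding Σ₅

  unique-quotient : ∀ (c : Fin 4) t → Σ₅ (λ i → δ₅ (suc c *₅ i) t) ≡ 1
  unique-quotient = from-yes (all? λ c → all? λ t → Σ₅ (λ i → δ₅ (suc c *₅ i) t) ℕ.≟ 1)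

-- Induction on coordinates. If the tail of `φ` is nonzero, each value of the first coordinate
-- leaves a fibre of the tail; if it is zero, the equation determines the first coordinate and
-- leaves the others free. The factor 5 avoids the exponent `n - 1`.
5*fibre≡ : ∀ {n} (φ : G n) t → φ ≢ 𝟎 → 5 * ΣG (λ x → δ₅ (φ · x) t) ≡ 5 ^ n
5*fibre≡ []      t φ≢𝟎 = ⊥-elim (φ≢𝟎 refl)
5*fibre≡ {suc n} (c ∷ φ) t φ≢𝟎 with φ ≟G 𝟎
5*fibre≡ {suc n} (zero  ∷ φ) t φ≢𝟎 | yes refl = ⊥-elim (φ≢𝟎 refl)
5*fibre≡ {suc n} (suc c ∷ φ) t φ≢𝟎 | yes refl = cong (5 *_) (begin
  ΣG (λ x → δ₅ ((suc c ∷ 𝟎) · x) t) ≡⟨ ΣG-∷ (λ x → δ₅ ((suc c ∷ 𝟎) · x) t) ⟩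
  Σ₅ (λ i → ΣG λ x → δ₅ ((suc c *₅ i) +₅ (𝟎 · x)) t)
    ≡⟨ Σ₅-cong (λ i → ΣG-cong λ x → cong (λ s → δ₅ s t)
         (trans (cong ((suc c *₅ i) +₅_) (𝟎· x)) (by-law₅ (′x :+ :0) ′x (suc c *₅ i ∷ [])))) ⟩
  Σ₅ (λ i → ΣG {n} λ x → δ₅ (suc c *₅ i) t) ≡⟨ Σ₅-cong (λ i → ΣG-const n (δ₅ (suc c *₅ i) t)) ⟩
  Σ₅ (λ i → 5 ^ n * δ₅ (suc c *₅ i) t)       ≡⟨ Σ₅-*ˡ (5 ^ n) (λ i → δ₅ (suc c *₅ i) t) ⟩
  5 ^ n * Σ₅ (λ i → δ₅ (suc c *₅ i) t)       ≡⟨ cong (5 ^ n *_) (unique-quotient c t) ⟩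
  5 ^ n * 1                                   ≡⟨ ℕ.*-identityʳ (5 ^ n) ⟩
  5 ^ n                                       ∎)
  where
  open ≡-Reasoning
5*fibre≡ {suc n} (c ∷ φ) t _ | no φ≢𝟎 = begin
  5 * ΣG (λ x → δ₅ ((c ∷ φ) · x) t) ≡⟨ cong (5 *_) (ΣG-∷ (λ x → δ₅ ((c ∷ φ) · x) t)) ⟩
  5 * Σ₅ (λ i → ΣG λ x → δ₅ ((c *₅ i) +₅ (φ · x)) t)
    ≡⟨ cong (5 *_) (Σ₅-cong λ i → ΣG-cong λ x → δ₅-+ (c *₅ i) (φ · x) t) ⟩
  5 * Σ₅ (λ i → ΣG λ x → δ₅ (φ · x) (t +₅ (-₅ (c *₅ i))))
    ≡⟨ Σ₅-*ˡ 5 (λ i → ΣG λ x → δ₅ (φ · x) (t +₅ (-₅ (c *₅ i)))) ⟨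
  Σ₅ (λ i → 5 * ΣG λ x → δ₅ (φ · x) (t +₅ (-₅ (c *₅ i))))
    ≡⟨ Σ₅-cong (λ i → 5*fibre≡ φ _ φ≢𝟎) ⟩
  Σ₅ (λ _ → 5 ^ n)
    ≡⟨ trans (Σ₅-expand _) (eq (5 ^ n)) ⟩
  5 ^ suc n ∎
  where
  open ≡-Reasoning
  eq : ∀ a → a + a + a + a + a ≡ 5 * a
  eq = solve-∀

fibre≡ : ∀ {m} (φ : G (suc m)) t → φ ≢ 𝟎 → ΣG (λ x → δ₅ (φ · x) t) ≡ 5 ^ m
fibre≡ {m} φ t φ≢𝟎 = ℕ.*-cancelˡ-≡ _ (5 ^ m) 5 (5*fibre≡ φ t φ≢𝟎)

5*annihilator≡ : ∀ {n} (g : G n) → g ≢ 𝟎 → 5 * ΣG (λ φ → δ₅ (φ · g) zero) ≡ 5 ^ n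
5*annihilator≡ g g≢𝟎 =
  trans (cong (5 *_) (ΣG-cong λ φ → cong (λ s → δ₅ s zero) (·-comm φ g))) (5*fibre≡ g zero g≢𝟎)

-- Averaging over all functionals

ΣA : ∀ {n} → Subset n → (G n → ℕ) → ℕ
ΣA A f = ΣG λ x → 𝟙 (A x) * f x

ΣA-cong : ∀ {n} (A : Subset n) {f g : G n → ℕ} → (∀ x → x ∈ A → f x ≡ g x) → ΣA A f ≡ ΣA A g
ΣA-cong A {f} {g} h = ΣG-cong λ x → on x (A x) refl
  where
  on : ∀ x b → A x ≡ b → 𝟙 b * f x ≡ 𝟙 b * g x
  on x true  x∈A = cong (1 *_) (h x x∈A)
  on x false _   = refl

ΣA-*ˡ : ∀ {n} (A : Subset n) k f → ΣA A (λ x → k * f x) ≡ k * ΣA A f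
ΣA-*ˡ A k f = trans (ΣG-cong λ x → eq (𝟙 (A x)) k (f x)) (ΣG-*ˡ k (λ x → 𝟙 (A x) * f x))
  where
  eq : ∀ a b c → a * (b * c) ≡ b * (a * c)
  eq = solve-∀

ΣA-const : ∀ {n} (A : Subset n) k → ΣA A (λ _ → k) ≡ ΣG (𝟙 ∘ A) * k
ΣA-const A k = ΣG-*ʳ (𝟙 ∘ A) k

ΣG-ΣA-swap : ∀ {m n} (A : Subset n) (f : G m → G n → ℕ) →
             ΣG (λ φ → ΣA A (f φ)) ≡ ΣA A λ x → ΣG λ φ → f φ x
ΣG-ΣA-swap A f = trans (ΣG-swap λ φ x → 𝟙 (A x) * f φ x) (ΣG-cong λ x → ΣG-*ˡ (𝟙 (A x)) (λ φ → f φ x))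

layer : ∀ {n} → Subset n → G n → Fin 5 → ℕ
layer A φ i = ΣA A λ x → δ₅ (φ · x) i

ΣA-by-layers : ∀ {n} (A : Subset n) φ (F : Fin 5 → ℕ) →
               ΣA A (λ x → F (φ · x)) ≡ Σ₅ λ i → layer A φ i * F i
ΣA-by-layers A φ F = begin
  ΣG (λ x → 𝟙 (A x) * F (φ · x))
    ≡⟨ ΣG-cong (λ x → cong (𝟙 (A x) *_) (sym (Σ₅-δ (φ · x) F))) ⟩
  ΣG (λ x → 𝟙 (A x) * Σ₅ (λ i → δ₅ (φ · x) i * F i))
    ≡⟨ ΣG-cong (λ x → sym (Σ₅-*ˡ (𝟙 (A x)) λ i → δ₅ (φ · x) i * F i)) ⟩
  ΣG (λ x → Σ₅ (λ i → 𝟙 (A x) * (δ₅ (φ · x) i * F i)))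
    ≡⟨ ΣG-Σ₅-swap (λ x i → 𝟙 (A x) * (δ₅ (φ · x) i * F i)) ⟩
  Σ₅ (λ i → ΣG λ x → 𝟙 (A x) * (δ₅ (φ · x) i * F i))
    ≡⟨ Σ₅-cong (λ i → trans (ΣG-cong λ x → sym (ℕ.*-assoc (𝟙 (A x)) (δ₅ (φ · x) i) (F i)))
                             (ΣG-*ʳ (λ x → 𝟙 (A x) * δ₅ (φ · x) i) (F i))) ⟩
  Σ₅ (λ i → layer A φ i * F i) ∎
  where open ≡-Reasoning

ΣG≡Σlayers : ∀ {n} (A : Subset n) φ → ΣG (𝟙 ∘ A) ≡ Σ₅ (layer A φ)
ΣG≡Σlayers A φ = begin
  ΣG (𝟙 ∘ A)                    ≡⟨ ℕ.*-identityʳ _ ⟨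
  ΣG (𝟙 ∘ A) * 1                ≡⟨ ΣA-const A 1 ⟨
  ΣA A (λ _ → 1)                ≡⟨ ΣA-by-layers A φ (λ _ → 1) ⟩
  Σ₅ (λ i → layer A φ i * 1)    ≡⟨ Σ₅-cong (λ i → ℕ.*-identityʳ _) ⟩
  Σ₅ (layer A φ)                ∎
  where open ≡-Reasoning

triples : ∀ {n} → Subset n → G n → ℕ
triples A φ = ΣA A λ x → ΣA A λ y → ΣA A λ z → δ₅ (φ · ((x ⊕ y) ⊕ z)) zero

pairs : ∀ {n} → Subset n → G n → ℕ
pairs A φ = ΣA A λ x → ΣA A λ y → δ₅ (φ · x) (φ · y)

onLayers : (ℕ → ℕ → ℕ → ℕ → ℕ → Set) → (Fin 5 → ℕ) → Set
onLayers P a = P (a (# 0)) (a (# 1)) (a (# 2)) (a (# 3)) (a (# 4))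

opaque
  unfolding Σ₅

  Σ₅³≡layers³ : ∀ (a : Fin 5 → ℕ) → Σ₅ (λ i → a i * Σ₅ λ j → a j * a (-₅ (i +₅ j))) ≡
                layers³ (a (# 0)) (a (# 1)) (a (# 2)) (a (# 3)) (a (# 4))
  Σ₅³≡layers³ a = eq (a (# 0)) (a (# 1)) (a (# 2)) (a (# 3)) (a (# 4))
    where
    eq : ∀ a b c d e →
      a * (a * a + b * e + c * d + d * c + e * b) + b * (a * e + b * d + c * c + d * b + e * a)
      + c * (a * d + b * c + c * b + d * a + e * e) + d * (a * c + b * b + c * a + d * e + e * d)
      + e * (a * b + b * a + c * e + d * d + e * c)
      ≡ a * a * a + 6 * (a * (b * e + c * d)) + 3 * (b * b * d + c * c * b + d * d * e + e * e * c)
    eq = solve-∀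

triples≡ : ∀ {n} (A : Subset n) φ → let a = layer A φ in
           triples A φ ≡ layers³ (a (# 0)) (a (# 1)) (a (# 2)) (a (# 3)) (a (# 4))
triples≡ A φ = begin
  triples A φ
    ≡⟨ ΣA-cong A (λ x _ → ΣA-cong A λ y _ → ΣA-cong A λ z _ → trans
         (cong (λ s → δ₅ s zero) (trans (·-⊕ φ (x ⊕ y) z) (cong (_+₅ (φ · z)) (·-⊕ φ x y))))
         (trans (δ₅-+ ((φ · x) +₅ (φ · y)) (φ · z) zero)
           (cong (δ₅ (φ · z)) (by-law₅ (:0 :- (′x :+ ′y)) (:- (′x :+ ′y)) (φ · x ∷ φ · y ∷ []))))) ⟩
  ΣA A (λ x → ΣA A λ y → a (-₅ ((φ · x) +₅ (φ · y))))
    ≡⟨ ΣA-cong A (λ x _ → ΣA-by-layers A φ λ j → a (-₅ ((φ · x) +₅ j))) ⟩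
  ΣA A (λ x → Σ₅ λ j → a j * a (-₅ ((φ · x) +₅ j)))
    ≡⟨ ΣA-by-layers A φ (λ i → Σ₅ λ j → a j * a (-₅ (i +₅ j))) ⟩
  Σ₅ (λ i → a i * Σ₅ λ j → a j * a (-₅ (i +₅ j)))
    ≡⟨ Σ₅³≡layers³ a ⟩
  layers³ (a (# 0)) (a (# 1)) (a (# 2)) (a (# 3)) (a (# 4)) ∎
  where
  open ≡-Reasoning
  a = layer A φ

pairs≡ : ∀ {n} (A : Subset n) φ → let a = layer A φ in
         pairs A φ ≡ layers² (a (# 0)) (a (# 1)) (a (# 2)) (a (# 3)) (a (# 4))
pairs≡ A φ = trans
  (ΣA-cong A λ x _ → ΣA-cong A λ y _ → δ₅-sym (φ · x) (φ · y))
  (trans (ΣA-by-layers A φ (layer A φ)) (Σ₅-expand _))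
  where
  δ₅-sym : ∀ a b → δ₅ a b ≡ δ₅ b a
  δ₅-sym = from-yes (all? λ a → all? λ b → δ₅ a b ℕ.≟ δ₅ b a)

ZeroSumFree : ∀ {n} → Subset n → Set
ZeroSumFree A = ∀ x y z → x ∈ A → y ∈ A → z ∈ A → (x ⊕ y) ⊕ z ≢ 𝟎

-- Double counting: the sum of a triple is never `𝟎`, so exactly a fifth of all functionals
-- annihilate it.
5*Σtriples : ∀ {n} (A : Subset n) → ZeroSumFree A →
  let S = ΣG (𝟙 ∘ A) in 5 * ΣG (triples A) ≡ S * (S * (S * 5 ^ n))
5*Σtriples {n} A zsf = begin
  5 * ΣG (triples A)
    ≡⟨ cong (5 *_) (trans (ΣG-ΣA-swap A _) (ΣA-cong A λ x _ →
         trans (ΣG-ΣA-swap A _) (ΣA-cong A λ y _ → ΣG-ΣA-swap A _))) ⟩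
  5 * ΣA A (λ x → ΣA A λ y → ΣA A λ z → K x y z)
    ≡⟨ trans (sym (ΣA-*ˡ A 5 _)) (ΣA-cong A λ x _ → trans (sym (ΣA-*ˡ A 5 _)) (ΣA-cong A λ y _ →
         sym (ΣA-*ˡ A 5 _))) ⟩
  ΣA A (λ x → ΣA A λ y → ΣA A λ z → 5 * K x y z)
    ≡⟨ ΣA-cong A (λ x x∈A → ΣA-cong A λ y y∈A → ΣA-cong A λ z z∈A →
         5*annihilator≡ ((x ⊕ y) ⊕ z) (zsf x y z x∈A y∈A z∈A)) ⟩
  ΣA A (λ x → ΣA A λ y → ΣA A λ z → 5 ^ n)
    ≡⟨ trans (ΣA-cong A λ x _ → trans (ΣA-cong A λ y _ → ΣA-const A _) (ΣA-const A _)) (ΣA-const A _) ⟩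
  S * (S * (S * 5 ^ n)) ∎
  where
  open ≡-Reasoning
  S = ΣG (𝟙 ∘ A)
  K : G n → G n → G n → ℕ
  K x y z = ΣG λ φ → δ₅ (φ · ((x ⊕ y) ⊕ z)) zero

5*Σδ : ∀ {n} (x y : G n) → 5 * ΣG (λ φ → δ₅ (φ · x) (φ · y)) ≡ 5 ^ n + 4 * 5 ^ n * δ x y
5*Σδ {n} x y with x ≟G y
... | yes refl = begin
  5 * ΣG (λ φ → δ₅ (φ · x) (φ · x)) ≡⟨ cong (5 *_) (trans (ΣG-cong λ φ → δ₅-refl (φ · x)) (ΣG-const n 1)) ⟩
  5 * (5 ^ n * 1)                     ≡⟨ eq (5 ^ n) ⟩
  5 ^ n + 4 * 5 ^ n * 1               ∎
  where
  open ≡-Reasoning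
  δ₅-refl : ∀ a → δ₅ a a ≡ 1
  δ₅-refl = from-yes (all? λ a → δ₅ a a ℕ.≟ 1)
  eq : ∀ a → 5 * (a * 1) ≡ a + 4 * a * 1
  eq = solve-∀
... | no x≢y = begin
  5 * ΣG (λ φ → δ₅ (φ · x) (φ · y))
    ≡⟨ cong (5 *_) (ΣG-cong λ φ → trans (δ₅-minus (φ · x) (φ · y)) (cong (λ s → δ₅ s zero) (sym (·-⊝ φ x y)))) ⟩
  5 * ΣG (λ φ → δ₅ (φ · (x ⊝ y)) zero) ≡⟨ 5*annihilator≡ (x ⊝ y) x⊝y≢𝟎 ⟩
  5 ^ n                                ≡⟨ eq (5 ^ n) ⟩
  5 ^ n + 4 * 5 ^ n * 0                ∎
  where
  open ≡-Reasoning
  x⊝y≢𝟎 : x ⊝ y ≢ 𝟎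
  x⊝y≢𝟎 h = x≢y (trans (by-law ′x ((′x :- ′y) :+ ′y) (x ∷ y ∷ []))
                  (trans (cong (_⊕ y) h) (by-law (:0 :+ ′x) ′x (y ∷ []))))
  eq : ∀ a → a ≡ a + 4 * a * 0
  eq = solve-∀

-- Parseval's identity in rational form: distinct points agree under a fifth of the functionals,
-- whereas each of the `S` diagonal pairs agrees under all of them, which adds `4 * 5 ^ n`.
5*Σpairs : ∀ {n} (A : Subset n) → let S = ΣG (𝟙 ∘ A) in
           5 * ΣG (pairs A) ≡ S * (S * 5 ^ n + 4 * 5 ^ n)
5*Σpairs {n} A = begin
  5 * ΣG (pairs A)
    ≡⟨ cong (5 *_) (trans (ΣG-ΣA-swap A _) (ΣA-cong A λ x _ → ΣG-ΣA-swap A _)) ⟩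
  5 * ΣA A (λ x → ΣA A λ y → ΣG λ φ → δ₅ (φ · x) (φ · y))
    ≡⟨ trans (sym (ΣA-*ˡ A 5 _)) (ΣA-cong A λ x _ → sym (ΣA-*ˡ A 5 _)) ⟩
  ΣA A (λ x → ΣA A λ y → 5 * ΣG λ φ → δ₅ (φ · x) (φ · y))
    ≡⟨ ΣA-cong A (λ x x∈A → trans (ΣA-cong A λ y _ → 5*Σδ x y) (inner x x∈A)) ⟩
  ΣA A (λ x → S * 5 ^ n + 4 * 5 ^ n)
    ≡⟨ ΣA-const A _ ⟩
  S * (S * 5 ^ n + 4 * 5 ^ n) ∎
  where
  open ≡-Reasoning
  S = ΣG (𝟙 ∘ A)
  inner : ∀ x → x ∈ A → ΣA A (λ y → 5 ^ n + 4 * 5 ^ n * δ x y) ≡ S * 5 ^ n + 4 * 5 ^ n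
  inner x x∈A = begin
    ΣG (λ y → 𝟙 (A y) * (5 ^ n + 4 * 5 ^ n * δ x y))
      ≡⟨ ΣG-cong (λ y → eq (𝟙 (A y)) (5 ^ n) (δ x y)) ⟩
    ΣG (λ y → 𝟙 (A y) * 5 ^ n + δ x y * (4 * 5 ^ n * 𝟙 (A y)))
      ≡⟨ ΣG-+ (λ y → 𝟙 (A y) * 5 ^ n) (λ y → δ x y * (4 * 5 ^ n * 𝟙 (A y))) ⟩
    ΣA A (λ _ → 5 ^ n) + ΣG (λ y → δ x y * (4 * 5 ^ n * 𝟙 (A y)))
      ≡⟨ cong₂ _+_ (ΣA-const A (5 ^ n)) (ΣG-δ x (λ y → 4 * 5 ^ n * 𝟙 (A y))) ⟩
    S * 5 ^ n + 4 * 5 ^ n * 𝟙 (A x)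
      ≡⟨ cong ((S * 5 ^ n) +_) (trans (cong (λ b → 4 * 5 ^ n * 𝟙 b) x∈A) (ℕ.*-identityʳ (4 * 5 ^ n))) ⟩
    S * 5 ^ n + 4 * 5 ^ n ∎
    where
    eq : ∀ a k d → a * (k + 4 * k * d) ≡ a * k + d * (4 * k * a)
    eq = solve-∀

-- Negative mean correlation above the density threshold

module _ where
  open +-*-Solver using (Polynomial; con; prove) renaming (_:*_ to _:×_)

  average-hyps : Vec (Ineq 2) 4
  average-hyps =
    (lit 0 ≲ N) ∷ (lit 0 ≲ S) ∷ (lit 3 ⊠ N ⊞ lit 1 ≲ lit 2 ⊠ S) ∷
    (lit 5 ⊠ N ⊠ R ⊞ (lit 70 ⊠ (S ⊠ (S ⊠ S)) ⊞ lit 45 ⊠ (N ⊠ (S ⊠ S))) ≲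
     lit 70 ⊠ (S ⊠ (S ⊠ (S ⊠ N))) ⊞ lit 45 ⊠ (N ⊠ (S ⊠ (S ⊠ N ⊞ lit 4 ⊠ N))) ⊞ R) ∷ []
    where
    N = ‵ # 0
    S = ‵ # 1
    R = lit 14 ⊠ (S ⊠ S ⊠ S) ⊞ lit 9 ⊠ (N ⊠ (S ⊠ S))

  -- From 180 N² S − 36 N S² − 56 S³ = − S (2 S − 3 N) (28 S + 60 N).
  average-cert : Cert 2 4
  average-cert = hyp (# 3) ⊞ S ⊠ hyp (# 2) ⊠ (lit 28 ⊠ S ⊞ lit 60 ⊠ N) ⊞ lit 60 ⊠ N ⊠ S
    where
    N S : Cert 2 4
    N = hyp (# 0)
    S = hyp (# 1)

  -- The spare 1 in `3 N + 1 ≤ 2 S`, multiplied by `S (28 S + 60 N)`, leaves a deficit of 28 S² + 60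
  -- N S, which is absurd once `S` is positive.
  average-contradiction : ∀ ρ → All (Holds ρ) average-hyps → Holds ρ (lit 28 ⊠ (‵ # 1 ⊠ ‵ # 1) ≲ lit 0)
  average-contradiction = certify average-hyps q 1 average-cert λ ρ →
    prove ρ (certPoly average-hyps average-cert) (con (pos 1) :× slack q) refl
    where q = lit 28 ⊠ (‵ # 1 ⊠ ‵ # 1) ≲ lit 0

average-impossible : ∀ N S (let R = 14 * (S * S * S) + 9 * (N * (S * S))) → 3 * N < 2 * S →
  5 * N * R + (70 * (S * (S * S)) + 45 * (N * (S * S))) ≤
  70 * (S * (S * (S * N))) + 45 * (N * (S * (S * N + 4 * N))) + R → ⊥
average-impossible N zero    ()
average-impossible N S@(suc _) big h = ℕ.n≮0 (average-contradiction (N ∷ S ∷ [])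
  (z≤n ∷ z≤n ∷ subst (_≤ 2 * S) (ℕ.+-comm 1 (3 * N)) big ∷ h ∷ []))

-- The bound may fail at `𝟎`. Exchanging the terms `L 𝟎` and `R` between the sides repairs this
-- without subtraction.
ΣG-average : ∀ {n} (R : ℕ) (L : G n → ℕ) → (∀ φ → φ ≢ 𝟎 → R ≤ L φ) → 5 ^ n * R + L 𝟎 ≤ ΣG L + R
ΣG-average {n} R L h = begin
  5 ^ n * R + L 𝟎                                 ≡⟨ cong₂ _+_ (ΣG-const n R) (ΣG-δ 𝟎 L) ⟨
  ΣG {n} (λ _ → R) + ΣG (λ φ → δ 𝟎 φ * L φ)       ≡⟨ ΣG-+ (λ _ → R) (λ φ → δ 𝟎 φ * L φ) ⟨
  ΣG (λ φ → R + δ 𝟎 φ * L φ)                      ≤⟨ ΣG-mono pointwise ⟩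
  ΣG (λ φ → L φ + δ 𝟎 φ * R)                      ≡⟨ ΣG-+ L (λ φ → δ 𝟎 φ * R) ⟩
  ΣG L + ΣG (λ φ → δ 𝟎 φ * R)                     ≡⟨ cong (ΣG L +_) (ΣG-δ 𝟎 (λ _ → R)) ⟩
  ΣG L + R                                         ∎
  where
  open ℕ.≤-Reasoning
  pointwise : ∀ φ → R + δ 𝟎 φ * L φ ≤ L φ + δ 𝟎 φ * R
  pointwise φ with 𝟎 ≟G φ
  ... | yes refl = ℕ.≤-reflexive (eq R (L 𝟎))
    where
    eq : ∀ a b → a + 1 * b ≡ b + 1 * a
    eq = solve-∀
  ... | no 𝟎≢φ = ℕ.+-monoˡ-≤ 0 (h φ (𝟎≢φ ∘ sym))

ΣG-linear : ∀ {n} a b N (t p : G n → ℕ) →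
            ΣG (λ φ → a * t φ + b * (N * p φ)) ≡ a * ΣG t + b * (N * ΣG p)
ΣG-linear a b N t p = trans (ΣG-+ (λ φ → a * t φ) (λ φ → b * (N * p φ)))
  (cong₂ _+_ (ΣG-*ˡ a t) (trans (ΣG-*ˡ b (λ φ → N * p φ)) (cong (b *_) (ΣG-*ˡ N p))))

dec-∃ : ∀ {n} {P Q : G n → Set} → (∀ x → Dec (P x)) → (∀ x → Dec (Q x)) →
        ¬ (∀ x → P x → Q x) → ∃ λ x → P x × ¬ Q x
dec-∃ P? Q? ¬∀ with anyG? (λ x → P? x ×-dec ¬? (Q? x))
... | yes found = found
... | no  none  = ⊥-elim (¬∀ λ x Px → decidable-stable (Q? x) λ ¬Qx → none (x , Px , ¬Qx))

module _ {m : ℕ} (A : Subset (suc m)) (zsf : ZeroSumFree A)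
         (big : 3 * 5 ^ m < 2 * ΣG (𝟙 ∘ A)) where
  private
    S : ℕ
    S = ΣG (𝟙 ∘ A)

    Σtriples : ΣG (triples A) ≡ S * (S * (S * 5 ^ m))
    Σtriples = ℕ.*-cancelˡ-≡ _ _ 5 (trans (5*Σtriples A zsf) (eq S (5 ^ m)))
      where
      eq : ∀ S N → S * (S * (S * (5 * N))) ≡ 5 * (S * (S * (S * N)))
      eq = solve-∀

    Σpairs : ΣG (pairs A) ≡ S * (S * 5 ^ m + 4 * 5 ^ m)
    Σpairs = ℕ.*-cancelˡ-≡ _ _ 5 (trans (5*Σpairs A) (eq S (5 ^ m)))
      where
      eq : ∀ S N → S * (S * (5 * N) + 4 * (5 * N)) ≡ 5 * (S * (S * N + 4 * N))
      eq = solve-∀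

    triples-𝟎 : triples A 𝟎 ≡ S * (S * S)
    triples-𝟎 = trans (ΣA-cong A λ x _ → trans (ΣA-cong A λ y _ → trans (ΣA-cong A λ z _ →
      cong (λ s → δ₅ s zero) (𝟎· ((x ⊕ y) ⊕ z))) (trans (ΣA-const A 1) (ℕ.*-identityʳ S)))
      (ΣA-const A S)) (ΣA-const A (S * S))

    pairs-𝟎 : pairs A 𝟎 ≡ S * S
    pairs-𝟎 = trans (ΣA-cong A λ x _ → trans (ΣA-cong A λ y _ → cong₂ δ₅ (𝟎· x) (𝟎· y))
      (trans (ΣA-const A 1) (ℕ.*-identityʳ S))) (ΣA-const A S)

    ¬all-correlated : ∀ a b R →
      (5 * 5 ^ m * R + (a * (S * (S * S)) + b * (5 ^ m * (S * S))) ≤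
       a * (S * (S * (S * 5 ^ m))) + b * (5 ^ m * (S * (S * 5 ^ m + 4 * 5 ^ m))) + R → ⊥) →
      ¬ (∀ φ → φ ≢ 𝟎 → R ≤ a * triples A φ + b * (5 ^ m * pairs A φ))
    ¬all-correlated a b R impossible h = impossible (subst₂ (λ l s → 5 * 5 ^ m * R + l ≤ s + R)
      (cong₂ (λ t p → a * t + b * (5 ^ m * p)) triples-𝟎 pairs-𝟎)
      (trans (ΣG-linear a b (5 ^ m) (triples A) (pairs A))
             (cong₂ (λ t p → a * t + b * (5 ^ m * p)) Σtriples Σpairs))
      (ΣG-average R (λ φ → a * triples A φ + b * (5 ^ m * pairs A φ)) h))

  opaque
    ∃uncorrelated : ∃ λ φ → φ ≢ 𝟎 × ¬ onLayers (Correlated (5 ^ m)) (layer A φ)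
    ∃uncorrelated = dec-∃ (λ φ → ¬? (φ ≟G 𝟎)) (λ φ → _ ≤? _) λ h →
      ¬all-correlated 70 45 _ (average-impossible (5 ^ m) S big) λ φ φ≢𝟎 → subst₂ _≤_
        (cong (λ s → 14 * (s * s * s) + 9 * (5 ^ m * (s * s))) (sym (trans (ΣG≡Σlayers A φ) (Σ₅-expand (layer A φ)))))
        (cong₂ (λ t p → 70 * t + 45 * (5 ^ m * p)) (sym (triples≡ A φ)) (sym (pairs≡ A φ)))
        (h φ φ≢𝟎)

-- Sumset bounds inside the fibres of a functional

size : ∀ {n} → Subset n → ℕ
size A = ΣG (𝟙 ∘ A)

does⇒ : ∀ {P : Set} (p? : Dec P) → does p? ≡ true → P
does⇒ (yes p) _ = p

ΣG-reflect : ∀ {n} (f : G n → ℕ) c → ΣG (λ x → f (c ⊝ x)) ≡ ΣG f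
ΣG-reflect f c = begin
  ΣG (λ x → f (c ⊝ x))   ≡⟨ ΣG-neg (λ y → f (c ⊕ y)) ⟩
  ΣG (λ y → f (c ⊕ y))   ≡⟨ ΣG-cong (λ y → cong f (by-law (′x :+ ′y) (′y :+ ′x) (c ∷ y ∷ []))) ⟩
  ΣG (λ y → f (y ⊕ c))   ≡⟨ ΣG-shift f c ⟩
  ΣG f                    ∎
  where open ≡-Reasoning

𝟙-disjoint : ∀ {a b c} → (a ≡ true → c ≡ true) → (b ≡ true → c ≡ true) →
             (a ≡ true → b ≡ true → ⊥) → 𝟙 a + 𝟙 b ≤ 𝟙 c
𝟙-disjoint {true}  {true}  {c}     h k d = ⊥-elim (d refl refl)
𝟙-disjoint {true}  {false} {true}  h k d = s≤s z≤n
𝟙-disjoint {true}  {false} {false} h k d with () ← h refl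
𝟙-disjoint {false} {true}  {true}  h k d = s≤s z≤n
𝟙-disjoint {false} {true}  {false} h k d with () ← k refl
𝟙-disjoint {false} {false} {c}     h k d = z≤n

𝟙-mono : ∀ {a b} → (a ≡ true → b ≡ true) → 𝟙 a ≤ 𝟙 b
𝟙-mono {true}  h rewrite h refl = s≤s z≤n
𝟙-mono {false} h = z≤n

ΣG-strict : ∀ {n} {f g : G n → ℕ} y → (∀ x → f x ≤ g x) → f y < g y → ΣG f < ΣG g
ΣG-strict {n} {f} {g} y f≤g fy<gy = begin
  1 + ΣG f                            ≡⟨ cong (_+ ΣG f) (ΣG-δ y (λ _ → 1)) ⟨
  ΣG (λ x → δ y x * 1) + ΣG f         ≡⟨ ΣG-+ (λ x → δ y x * 1) f ⟨
  ΣG (λ x → δ y x * 1 + f x)          ≤⟨ ΣG-mono pointwise ⟩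
  ΣG g                                ∎
  where
  open ℕ.≤-Reasoning
  pointwise : ∀ x → δ y x * 1 + f x ≤ g x
  pointwise x with y ≟G x
  ... | yes refl = fy<gy
  ... | no _     = f≤g x

0<size : ∀ {n} (A : Subset n) {x} → x ∈ A → 0 < size A
0<size {n} A {x} x∈A = subst (_< size A) (ΣG-0 n)
  (ΣG-strict x (λ _ → z≤n) (subst (λ b → 0 < 𝟙 b) (sym x∈A) (s≤s z≤n)))

InFibre : ∀ {n} → G n → Fin 5 → Subset n → Set
InFibre φ t X = ∀ x → x ∈ X → φ · x ≡ t

in-fibre : ∀ {n} (φ : G n) {t x} → φ · x ≡ t → does (φ · x ≟F t) ≡ true
in-fibre φ {t} {x} h = dec-true (φ · x ≟F t) h

-- `X` and the reflection of `Y` in `c` are disjoint subsets of one and the same fibre, the one over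
-- `i`.
size-pair : ∀ {m} {φ : G (suc m)} → φ ≢ 𝟎 → ∀ {i j X Y} → InFibre φ i X → InFibre φ j Y →
            ∀ c → φ · c ≡ i +₅ j → (∀ x → x ∈ X → (c ⊝ x) ∈ Y → ⊥) → size X + size Y ≤ 5 ^ m
size-pair {m} {φ} φ≢𝟎 {i} {j} {X} {Y} X⊆ Y⊆ c φc disjoint = begin
  size X + size Y                              ≡⟨ cong (size X +_) (ΣG-reflect (𝟙 ∘ Y) c) ⟨
  size X + ΣG (λ x → 𝟙 (Y (c ⊝ x)))            ≡⟨ ΣG-+ (𝟙 ∘ X) (λ x → 𝟙 (Y (c ⊝ x))) ⟨
  ΣG (λ x → 𝟙 (X x) + 𝟙 (Y (c ⊝ x)))           ≤⟨ ΣG-mono (λ x → 𝟙-disjoint {X x} {Y (c ⊝ x)}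
                                                    (λ h → in-fibre φ (X⊆ x h)) (λ h → in-fibre φ (back x h)) (disjoint x)) ⟩
  ΣG (λ x → δ₅ (φ · x) i)                      ≡⟨ fibre≡ φ i φ≢𝟎 ⟩
  5 ^ m                                        ∎
  where
  open ℕ.≤-Reasoning
  back : ∀ x → (c ⊝ x) ∈ Y → φ · x ≡ i
  back x h = trans (by-law₅ ′x (′y :- (′y :- ′x)) (φ · x ∷ φ · c ∷ []))
    (trans (cong₂ (λ s t → s +₅ (-₅ t)) φc (trans (sym (·-⊝ φ c x)) (Y⊆ (c ⊝ x) h)))
           (by-law₅ ((′x :+ ′y) :- ′y) ′x (i ∷ j ∷ [])))

-- Disjoint translates and Dyson's transform

mulT : ∀ {k} → ℕ → Term k → Term k
mulT zero    t = :0
mulT (suc r) t = mulT r t :+ t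

mulG : ∀ {n} → ℕ → G n → G n
mulG zero    x = 𝟎
mulG (suc r) x = mulG r x ⊕ x

evalG-mulT : ∀ {k n} (ρ : Vec (G n) k) r t → evalG ρ (mulT r t) ≡ mulG r (evalG ρ t)
evalG-mulT ρ zero    t = refl
evalG-mulT ρ (suc r) t = cong (_⊕ evalG ρ t) (evalG-mulT ρ r t)

·-mulG : ∀ {n} (φ g : G n) → φ · g ≡ zero → ∀ r → φ · mulG r g ≡ zero
·-mulG φ g φg zero    = trans (·-comm φ 𝟎) (𝟎· φ)
·-mulG φ g φg (suc r) = trans (·-⊕ φ (mulG r g) g) (cong₂ _+₅_ (·-mulG φ g φg r) φg)

gap : Fin 5 → Fin 5 → Term 2
gap s t = (′y :- mulT (toℕ t) ′x) :- (′y :- mulT (toℕ s) ′x)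

opaque
  -- `gap s t` is s - t times `′x`, and `r` is the inverse of s - t modulo 5. The cancelling `′y` is
  -- kept because the gap occurs below as the difference of two points of `Y`.
  gap-generates : ∀ (s t : Fin 5) → s ≢ t → ∃ λ (r : Fin 5) → Law₅ (mulT (toℕ r) (gap s t)) ′x
  gap-generates = toWitness {a? = all? λ s → all? λ t → ¬? (s ≟F t) →-dec any? λ r → law₅? (mulT (toℕ r) (gap s t)) ′x} _

Σ₅-at-most-one : ∀ (b : Fin 5 → Bool) {c} → (∀ t → b t ≡ true → c ≡ true) →
                 (∀ s t → s ≢ t → b s ≡ true → b t ≡ true → ⊥) → Σ₅ (𝟙 ∘ b) ≤ 𝟙 c
Σ₅-at-most-one b {c} sub disjoint with any? (λ t → b t Bool.≟ true)
... | yes (t , bt) = begin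
  Σ₅ (𝟙 ∘ b)              ≤⟨ Σ₅-mono pointwise ⟩
  Σ₅ (λ s → δ₅ t s * 1)   ≡⟨ Σ₅-δ t (λ _ → 1) ⟩
  1                       ≡⟨ cong 𝟙 (sub t bt) ⟨
  𝟙 c                     ∎
  where
  open ℕ.≤-Reasoning
  pointwise : ∀ s → 𝟙 (b s) ≤ δ₅ t s * 1
  pointwise s with t ≟F s
  ... | yes refl = 𝟙-mono {b s} {true} λ _ → refl
  ... | no t≢s with b s in bs
  ...   | true  = ⊥-elim (disjoint t s t≢s bt bs)
  ...   | false = z≤n
... | no none = begin
  Σ₅ (𝟙 ∘ b)       ≤⟨ Σ₅-mono (λ s → 𝟙-mono {b s} {false} λ bs → ⊥-elim (none (s , bs))) ⟩
  Σ₅ (λ _ → 0)     ≡⟨ Σ₅-expand (λ _ → 0) ⟩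
  0                ≤⟨ z≤n ⟩
  𝟙 c              ∎
  where open ℕ.≤-Reasoning

module _ {m : ℕ} {φ : G (suc m)} (φ≢𝟎 : φ ≢ 𝟎) {i j k : Fin 5} (k≡ : k ≡ -₅ (i +₅ j))
         (Z : Subset (suc m)) (Z⊆ : InFibre φ k Z) {z₀ : G (suc m)} (z₀∈Z : z₀ ∈ Z) where

  Sumfree₃ : Subset (suc m) → Subset (suc m) → Set
  Sumfree₃ X Y = ∀ x y z → x ∈ X → y ∈ Y → z ∈ Z → (x ⊕ y) ⊕ z ≢ 𝟎

  module _ {X Y : Subset (suc m)} (X⊆ : InFibre φ i X) (Y⊆ : InFibre φ j Y)
           {x₀ : G (suc m)} (x₀∈X : x₀ ∈ X) {y₀ : G (suc m)} (y₀∈Y : y₀ ∈ Y)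
           (free : Sumfree₃ X Y) where

    size-XZ : size X + size Z ≤ 5 ^ m
    size-XZ = size-pair φ≢𝟎 X⊆ Z⊆ (⊖ y₀)
      (trans (·-⊖ φ y₀) (trans (cong -₅_ (Y⊆ y₀ y₀∈Y))
        (trans (by-law₅ (:- ′y) (′x :- (′x :+ ′y)) (i ∷ j ∷ [])) (cong (i +₅_) (sym k≡)))))
      λ x x∈X h → free x y₀ _ x∈X y₀∈Y h
        (by-law ((′x :+ ′y) :+ (:- ′y :- ′x)) :0 (x ∷ y₀ ∷ []))

    module _ (stable : ∀ x y y′ → x ∈ X → y ∈ Y → y′ ∈ Y → (y′ ⊕ (x ⊝ y)) ∈ X) where
      private
        -- Chosen so that `x₀ ⊕ g` is -(y₀ + z₀), which sum-freeness keeps out of `X`. It lies in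
        -- the kernel of `φ`, so translating by it preserves fibres.
        g : G (suc m)
        g = ((⊖ z₀) ⊝ y₀) ⊝ x₀

        φg : φ · g ≡ zero
        φg = begin
          φ · g                                                     ≡⟨ ·-⊝ φ ((⊖ z₀) ⊝ y₀) x₀ ⟩
          (φ · ((⊖ z₀) ⊝ y₀)) +₅ (-₅ (φ · x₀))                      ≡⟨ cong₂ (λ s t → s +₅ (-₅ t)) (·-⊝ φ (⊖ z₀) y₀) (X⊆ x₀ x₀∈X) ⟩
          ((φ · (⊖ z₀)) +₅ (-₅ (φ · y₀))) +₅ (-₅ i)                 ≡⟨ cong₂ (λ s t → (s +₅ (-₅ t)) +₅ (-₅ i)) (trans (·-⊖ φ z₀) (cong -₅_ (trans (Z⊆ z₀ z₀∈Z) k≡))) (Y⊆ y₀ y₀∈Y) ⟩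
          ((-₅ (-₅ (i +₅ j))) +₅ (-₅ j)) +₅ (-₅ i)                  ≡⟨ by-law₅ ((:- :- (′x :+ ′y) :- ′y) :- ′x) :0 (i ∷ j ∷ []) ⟩
          zero                                                      ∎
          where open ≡-Reasoning

        x₀⊕g∉X : (x₀ ⊕ g) ∈ X → ⊥
        x₀⊕g∉X h = free _ y₀ z₀ h y₀∈Y z₀∈Z
          (by-law ((′x :+ ((:- ′z :- ′y) :- ′x)) :+ ′y :+ ′z) :0 (x₀ ∷ y₀ ∷ z₀ ∷ []))

        iterate : ∀ {y y′} → y ∈ Y → y′ ∈ Y → ∀ r {x} → x ∈ X → (x ⊕ mulG r (y′ ⊝ y)) ∈ X
        iterate y∈ y′∈ zero {x} x∈ = subst (_∈ X) (by-law ′x (′x :+ :0) (x ∷ [])) x∈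
        iterate {y} {y′} y∈ y′∈ (suc r) {x} x∈ = subst (_∈ X)
          (by-law (′y :+ ((′z :+ ′w) :- ′x)) (′z :+ (′w :+ (′y :- ′x))) (y ∷ y′ ∷ x ∷ mulG r (y′ ⊝ y) ∷ []))
          (stable _ y y′ (iterate y∈ y′∈ r x∈) y∈ y′∈)

        disjoint : ∀ x s t → s ≢ t → (x ⊝ mulG (toℕ s) g) ∈ Y → (x ⊝ mulG (toℕ t) g) ∈ Y → ⊥
        disjoint x s t s≢t hs ht with gap-generates s t s≢t
        ... | r , law = x₀⊕g∉X (subst (λ y → (x₀ ⊕ y) ∈ X) eq (iterate hs ht (toℕ r) x₀∈X))
          where
          ρ = g ∷ x ∷ []
          eq : mulG (toℕ r) ((x ⊝ mulG (toℕ t) g) ⊝ (x ⊝ mulG (toℕ s) g)) ≡ g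
          eq = trans (sym (trans (evalG-mulT ρ (toℕ r) (gap s t)) (cong (mulG (toℕ r))
            (cong₂ (λ a b → (x ⊝ a) ⊝ (x ⊝ b)) (evalG-mulT ρ (toℕ t) ′x) (evalG-mulT ρ (toℕ s) ′x)))))
            (lift {s = mulT (toℕ r) (gap s t)} {′x} law ρ)

        fibre-Y : ∀ x (t : Fin 5) → (x ⊝ mulG (toℕ t) g) ∈ Y → does (φ · x ≟F j) ≡ true
        fibre-Y x t h = in-fibre φ (trans (trans (by-law₅ ′x (′x :- :0) (φ · x ∷ []))
          (trans (cong (λ s → (φ · x) +₅ (-₅ s)) (sym (·-mulG φ g φg (toℕ t)))) (sym (·-⊝ φ x (mulG (toℕ t) g)))))
          (Y⊆ _ h))

      -- The translates of `Y` by the five multiples of `g` are disjoint inside the fibre over `j`.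
      -- A point common to two of them puts a nonzero multiple of `g` into Y - Y; as `X` is stable
      -- under Y - Y and 5 is prime, `X` would then contain `x₀ ⊕ g`.
      5*size-Y : 5 * size Y ≤ 5 ^ m
      5*size-Y = begin
        5 * size Y                                               ≡⟨ eq (size Y) ⟩
        size Y + size Y + size Y + size Y + size Y               ≡⟨ Σ₅-expand (λ _ → size Y) ⟨
        Σ₅ (λ _ → size Y)                                        ≡⟨ Σ₅-cong (λ t → ΣG-shift (𝟙 ∘ Y) (⊖ mulG (toℕ t) g)) ⟨
        Σ₅ (λ t → ΣG λ x → 𝟙 (Y (x ⊝ mulG (toℕ t) g)))           ≡⟨ ΣG-Σ₅-swap (λ x t → 𝟙 (Y (x ⊝ mulG (toℕ t) g))) ⟨
        ΣG (λ x → Σ₅ λ t → 𝟙 (Y (x ⊝ mulG (toℕ t) g)))           ≤⟨ ΣG-mono (λ x → Σ₅-at-most-one _ (fibre-Y x) (disjoint x)) ⟩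
        ΣG (λ x → δ₅ (φ · x) j)                                  ≡⟨ fibre≡ φ j φ≢𝟎 ⟩
        5 ^ m                                                    ∎
        where
        open ℕ.≤-Reasoning
        eq : ∀ a → 5 * a ≡ a + a + a + a + a
        eq = solve-∀

      stable-bound : 5 * (size X + size Y + size Z) ≤ 6 * 5 ^ m
      stable-bound = begin
        5 * (size X + size Y + size Z)          ≡⟨ eq (size X) (size Y) (size Z) ⟩
        5 * (size X + size Z) + 5 * size Y      ≤⟨ ℕ.+-mono-≤ (ℕ.*-monoʳ-≤ 5 size-XZ) 5*size-Y ⟩
        5 * 5 ^ m + 5 ^ m                       ≡⟨ eq′ (5 ^ m) ⟩
        6 * 5 ^ m                               ∎
        where
        open ℕ.≤-Reasoning
        eq : ∀ x y z → 5 * (x + y + z) ≡ 5 * (x + z) + 5 * y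
        eq = solve-∀
        eq′ : ∀ a → 5 * a + a ≡ 6 * a
        eq′ = solve-∀

  -- A weak form of Kneser's theorem, by Dyson's e-transform (X , Y) ↦ (X ∪ (Y + e) , Y ∩ (X − e)).
  kneser-bound : ∀ fuel {X Y} → size Y ≤ fuel → InFibre φ i X → InFibre φ j Y →
    ∀ {x₀} → x₀ ∈ X → ∀ {y₀} → y₀ ∈ Y → Sumfree₃ X Y → 5 * (size X + size Y + size Z) ≤ 6 * 5 ^ m
  kneser-bound zero {Y = Y} h _ _ _ y₀∈Y _ = ⊥-elim (ℕ.n≮0 (ℕ.≤-trans (0<size Y y₀∈Y) h))
  kneser-bound (suc fuel) {X} {Y} h X⊆ Y⊆ x₀∈X y₀∈Y free
    with anyG? (λ x → anyG? λ y → anyG? λ y′ → (X x Bool.≟ true) ×-dec (Y y Bool.≟ true) ×-dec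
                (Y y′ Bool.≟ true) ×-dec ¬? (X (y′ ⊕ (x ⊝ y)) Bool.≟ true))
  ... | no none = stable-bound X⊆ Y⊆ x₀∈X y₀∈Y free λ x y y′ x∈ y∈ y′∈ →
        decidable-stable (X (y′ ⊕ (x ⊝ y)) Bool.≟ true) λ ∉X → none (x , y , y′ , x∈ , y∈ , y′∈ , ∉X)
  -- For e = x - y the transform keeps `y` in the second set, since y + e = x is in `X`, and removes
  -- `y′`, since y′ + e is not. So the second set shrinks but stays inhabited, while the sum of the
  -- sizes is unchanged.
  ... | yes (x , y , y′ , x∈ , y∈ , y′∈ , ∉X) = subst (λ s → 5 * (s + size Z) ≤ 6 * 5 ^ m) sizes
        (kneser-bound fuel (ℕ.≤-pred (ℕ.≤-trans smaller h)) X′⊆ Y′⊆ x∈X′ y∈Y′ free′)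
    where
    e : G (suc m)
    e = x ⊝ y
    X′ Y′ : Subset (suc m)
    X′ u = X u ∨ Y (u ⊝ e)
    Y′ u = Y u ∧ X (u ⊕ e)
    φe : φ · e ≡ i +₅ (-₅ j)
    φe = trans (·-⊝ φ x y) (cong₂ (λ s t → s +₅ (-₅ t)) (X⊆ x x∈) (Y⊆ y y∈))
    ∈X′ : ∀ {u} → u ∈ X′ → u ∈ X ⊎ (u ⊝ e) ∈ Y
    ∈X′ {u} q with X u
    ... | true  = inj₁ refl
    ... | false = inj₂ q
    ∈Y′ : ∀ {u} → u ∈ Y′ → u ∈ Y × (u ⊕ e) ∈ X
    ∈Y′ {u} q with Y u
    ... | true = refl , q
    X′⊆ : InFibre φ i X′
    X′⊆ u q with ∈X′ q
    ... | inj₁ u∈X = X⊆ u u∈X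
    ... | inj₂ u⊝e∈Y = trans (by-law₅ ′x ((′x :- ′y) :+ ′y) (φ · u ∷ φ · e ∷ []))
          (trans (cong₂ _+₅_ (trans (sym (·-⊝ φ u e)) (Y⊆ _ u⊝e∈Y)) φe)
                 (by-law₅ (′y :+ (′x :- ′y)) ′x (i ∷ j ∷ [])))
    Y′⊆ : InFibre φ j Y′
    Y′⊆ u q = Y⊆ u (proj₁ (∈Y′ q))
    x∈X′ : x ∈ X′
    x∈X′ rewrite x∈ = refl
    y∈Y′ : y ∈ Y′
    y∈Y′ rewrite y∈ = trans (cong X (by-law (′y :+ (′x :- ′y)) ′x (x ∷ y ∷ []))) x∈
    free′ : Sumfree₃ X′ Y′
    free′ u v z u∈ v∈ z∈ with ∈X′ u∈ | ∈Y′ v∈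
    ... | inj₁ u∈X   | v∈Y , _     = free u v z u∈X v∈Y z∈
    -- Moving `e` from `u` to `v` writes u + v as a sum of an element of `X` and one of `Y`, so the
    -- transform creates no new sums.
    ... | inj₂ u⊝e∈Y | _   , v⊕e∈X = λ q → free (v ⊕ e) (u ⊝ e) z v⊕e∈X u⊝e∈Y z∈
          (trans (by-law (((′y :+ ′w) :+ (′x :- ′w)) :+ ′z) ((′x :+ ′y) :+ ′z) (u ∷ v ∷ z ∷ e ∷ [])) q)
    smaller : size Y′ < size Y
    smaller = ΣG-strict y′ (λ u → 𝟙-mono (proj₁ ∘ ∈Y′)) strict
      where
      strict : 𝟙 (Y y′ ∧ X (y′ ⊕ e)) < 𝟙 (Y y′)
      strict rewrite y′∈ | Bool.¬-not ∉X = s≤s z≤n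
    sizes : size X′ + size Y′ ≡ size X + size Y
    sizes = begin
      size X′ + size Y′
        ≡⟨ cong (size X′ +_) (ΣG-shift (𝟙 ∘ Y′) (⊖ e)) ⟨
      size X′ + ΣG (λ u → 𝟙 (Y (u ⊝ e) ∧ X ((u ⊝ e) ⊕ e)))
        ≡⟨ ΣG-+ (𝟙 ∘ X′) (λ u → 𝟙 (Y (u ⊝ e) ∧ X ((u ⊝ e) ⊕ e))) ⟨
      ΣG (λ u → 𝟙 (X u ∨ Y (u ⊝ e)) + 𝟙 (Y (u ⊝ e) ∧ X ((u ⊝ e) ⊕ e)))
        ≡⟨ ΣG-cong (λ u → trans (cong (λ w → 𝟙 (X u ∨ Y (u ⊝ e)) + 𝟙 (Y (u ⊝ e) ∧ X w))
             (by-law ((′x :- ′y) :+ ′y) ′x (u ∷ e ∷ []))) (∨∧ (X u) (Y (u ⊝ e)))) ⟩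
      ΣG (λ u → 𝟙 (X u) + 𝟙 (Y (u ⊝ e)))
        ≡⟨ ΣG-+ (𝟙 ∘ X) (λ u → 𝟙 (Y (u ⊝ e))) ⟩
      size X + ΣG (λ u → 𝟙 (Y (u ⊝ e)))
        ≡⟨ cong (size X +_) (ΣG-shift (𝟙 ∘ Y) (⊖ e)) ⟩
      size X + size Y ∎
      where
      open ≡-Reasoning
      ∨∧ : ∀ a b → 𝟙 (a ∨ b) + 𝟙 (b ∧ a) ≡ 𝟙 a + 𝟙 b
      ∨∧ true  true  = refl
      ∨∧ true  false = refl
      ∨∧ false true  = refl
      ∨∧ false false = refl

-- Layers of a zero-sum-free set

slice : ∀ {n} → Subset n → G n → Fin 5 → Subset n
slice A φ i x = A x ∧ does (φ · x ≟F i)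

slice⊆ : ∀ {n} (A : Subset n) φ i {x} → x ∈ slice A φ i → x ∈ A
slice⊆ A φ i {x} h with A x
... | true = refl

slice-fibre : ∀ {n} (A : Subset n) φ i → InFibre φ i (slice A φ i)
slice-fibre A φ i x h with A x
... | true = does⇒ (φ · x ≟F i) h

slice∋ : ∀ {n} (A : Subset n) φ {i x} → x ∈ A → φ · x ≡ i → x ∈ slice A φ i
slice∋ A φ x∈A p rewrite x∈A = in-fibre φ p

layer≡size : ∀ {n} (A : Subset n) φ i → layer A φ i ≡ size (slice A φ i)
layer≡size A φ i = ΣG-cong λ x → 𝟙-∧ (A x) (does (φ · x ≟F i))
  where
  𝟙-∧ : ∀ a b → 𝟙 a * 𝟙 b ≡ 𝟙 (a ∧ b)
  𝟙-∧ true  b = ℕ.*-identityˡ (𝟙 b)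
  𝟙-∧ false b = refl

size≢0⇒∃ : ∀ {n} (A : Subset n) → size A ≢ 0 → ∃ λ x → x ∈ A
size≢0⇒∃ {n} A h with anyG? (λ x → A x Bool.≟ true)
... | yes found = found
... | no none = ⊥-elim (h (trans (ΣG-cong λ x → cong 𝟙 (Bool.¬-not λ x∈A → none (x , x∈A))) (ΣG-0 n)))

layer≢0⇒∃ : ∀ {n} (A : Subset n) φ i → layer A φ i ≢ 0 → ∃ λ x → x ∈ slice A φ i
layer≢0⇒∃ A φ i h = size≢0⇒∃ (slice A φ i) (h ∘ trans (layer≡size A φ i))

∈⇒layer≢0 : ∀ {n} (A : Subset n) φ {x} → x ∈ A → layer A φ (φ · x) ≢ 0
∈⇒layer≢0 A φ x∈A h = ℕ.<-irrefl (sym (trans (sym (layer≡size A φ _)) h)) (0<size (slice A φ _) (slice∋ A φ x∈A refl))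

module _ {m : ℕ} {A : Subset (suc m)} (zsf : ZeroSumFree A) {φ : G (suc m)} (φ≢𝟎 : φ ≢ 𝟎) where
  private
    A[_] : Fin 5 → Subset (suc m)
    A[ i ] = slice A φ i

  layer-pair : ∀ i j → layer A φ (-₅ (i +₅ j)) ≢ 0 → layer A φ i + layer A φ j ≤ 5 ^ m
  layer-pair i j h with layer≢0⇒∃ A φ (-₅ (i +₅ j)) h
  ... | z , z∈ = subst₂ (λ s t → s + t ≤ 5 ^ m) (sym (layer≡size A φ i)) (sym (layer≡size A φ j))
    (size-pair φ≢𝟎 {X = A[ i ]} {A[ j ]} (slice-fibre A φ i) (slice-fibre A φ j) (⊖ z)
      (trans (·-⊖ φ z) (trans (cong -₅_ (slice-fibre A φ _ z z∈)) (by-law₅ (:- :- (′x :+ ′y)) (′x :+ ′y) (i ∷ j ∷ []))))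
      λ x x∈ y∈ → zsf x _ z (slice⊆ A φ i x∈) (slice⊆ A φ j y∈) (slice⊆ A φ _ z∈)
        (by-law ((′x :+ (:- ′y :- ′x)) :+ ′y) :0 (x ∷ z ∷ [])))

  layer-triple : ∀ i j → layer A φ i ≢ 0 → layer A φ j ≢ 0 → layer A φ (-₅ (i +₅ j)) ≢ 0 →
                 5 * (layer A φ i + layer A φ j + layer A φ (-₅ (i +₅ j))) ≤ 6 * 5 ^ m
  layer-triple i j hi hj hk
    with layer≢0⇒∃ A φ i hi | layer≢0⇒∃ A φ j hj | layer≢0⇒∃ A φ (-₅ (i +₅ j)) hk
  ... | x , x∈ | y , y∈ | z , z∈ = subst (λ s → 5 * s ≤ 6 * 5 ^ m)
    (sym (cong₂ _+_ (cong₂ _+_ (layer≡size A φ i) (layer≡size A φ j)) (layer≡size A φ (-₅ (i +₅ j)))))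
    (kneser-bound φ≢𝟎 refl A[ -₅ (i +₅ j) ] (slice-fibre A φ _) z∈
      (size A[ j ]) {A[ i ]} {A[ j ]} ℕ.≤-refl (slice-fibre A φ i) (slice-fibre A φ j) x∈ y∈
      λ u v w u∈ v∈ w∈ → zsf u v w (slice⊆ A φ i u∈) (slice⊆ A φ j v∈) (slice⊆ A φ _ w∈))

-- Numerical constraints on the layer sizes and the possible supports

record Config (N : ℕ) (a : Fin 5 → ℕ) : Set where
  field
    pair         : ∀ i j → a (-₅ (i +₅ j)) ≢ 0 → a i + a j ≤ N
    triple       : ∀ i j → a i ≢ 0 → a j ≢ 0 → a (-₅ (i +₅ j)) ≢ 0 →
                   5 * (a i + a j + a (-₅ (i +₅ j))) ≤ 6 * N
    big          : 3 * N < 2 * (a (# 0) + a (# 1) + a (# 2) + a (# 3) + a (# 4))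
    uncorrelated : ¬ onLayers (Correlated N) a

-- The constraints are invariant under automorphisms of ℤ₅. Since 2 generates its unit group,
-- iterating this map reaches every dilation, and each support needs treatment only up to dilation.
double : ∀ {N a} → Config N a → Config N (a ∘ ((# 2) *₅_))
double {N} {a} c = record
  { pair   = λ i j h → pair _ _ (h ∘ trans (cong a (2*neg i j)))
  ; triple = λ i j hi hj hk → subst (λ k → 5 * (a ((# 2) *₅ i) + a ((# 2) *₅ j) + a k) ≤ 6 * N) (sym (2*neg i j))
      (triple _ _ hi hj (hk ∘ trans (cong a (2*neg i j))))
  ; big          = subst (λ s → 3 * N < 2 * s) (sym Σ-double) big
  ; uncorrelated = uncorrelated ∘ correlated-cong Σ-double Σ³-double Σ²-double
  }
  where
  open Config c
  2*neg : ∀ i j → (# 2) *₅ (-₅ (i +₅ j)) ≡ -₅ (((# 2) *₅ i) +₅ ((# 2) *₅ j))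
  2*neg = from-yes (all? λ i → all? λ j → (# 2) *₅ (-₅ (i +₅ j)) ≟F -₅ (((# 2) *₅ i) +₅ ((# 2) *₅ j)))
  a₀ = a (# 0)
  a₁ = a (# 1)
  a₂ = a (# 2)
  a₃ = a (# 3)
  a₄ = a (# 4)
  Σ-double : a₀ + a₂ + a₄ + a₁ + a₃ ≡ a₀ + a₁ + a₂ + a₃ + a₄
  Σ-double = eq a₀ a₁ a₂ a₃ a₄
    where
    eq : ∀ a b c d e → a + c + e + b + d ≡ a + b + c + d + e
    eq = solve-∀
  Σ³-double : layers³ a₀ a₂ a₄ a₁ a₃ ≡ layers³ a₀ a₁ a₂ a₃ a₄
  Σ³-double = eq a₀ a₁ a₂ a₃ a₄
    where
    eq : ∀ a b c d e →
      a * a * a + 6 * (a * (c * d + e * b)) + 3 * (c * c * b + e * e * c + b * b * d + d * d * e) ≡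
      a * a * a + 6 * (a * (b * e + c * d)) + 3 * (b * b * d + c * c * b + d * d * e + e * e * c)
    eq = solve-∀
  Σ²-double : layers² a₀ a₂ a₄ a₁ a₃ ≡ layers² a₀ a₁ a₂ a₃ a₄
  Σ²-double = eq a₀ a₁ a₂ a₃ a₄
    where
    eq : ∀ a b c d e → a * a + c * c + e * e + b * b + d * d ≡ a * a + b * b + c * c + d * d + e * e
    eq = solve-∀
  correlated-cong : ∀ {s s′ t t′ p p′} → s ≡ s′ → t ≡ t′ → p ≡ p′ →
    14 * (s * s * s) + 9 * (N * (s * s)) ≤ 70 * t + 45 * (N * p) →
    14 * (s′ * s′ * s′) + 9 * (N * (s′ * s′)) ≤ 70 * t′ + 45 * (N * p′)
  correlated-cong refl refl refl h = h

module _ {N : ℕ} {a : Fin 5 → ℕ} (c : Config N a) where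
  open Config c
  private
    a₀ = a (# 0)
    a₁ = a (# 1)
    a₂ = a (# 2)
    a₃ = a (# 3)
    a₄ = a (# 4)

    2*≤ : ∀ x → x + x ≤ N → 2 * x ≤ N
    2*≤ x = subst (_≤ N) (cong (_+_ x) (sym (ℕ.+-identityʳ x)))

    ≤⇒¬big : ∀ {s} → 2 * s ≤ 3 * N → s ≡ a₀ + a₁ + a₂ + a₃ + a₄ → ⊥
    ≤⇒¬big h refl = ℕ.<⇒≱ big h

    5a₀≤2N : a₀ ≢ 0 → 5 * a₀ ≤ 2 * N
    5a₀≤2N h = ℕ.*-cancelˡ-≤ 3 (subst₂ _≤_ (eq a₀) (eq′ N) (triple (# 0) (# 0) h h h))
      where
      eq : ∀ x → 5 * (x + x + x) ≡ 3 * (5 * x)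
      eq = solve-∀
      eq′ : ∀ x → 6 * x ≡ 3 * (2 * x)
      eq′ = solve-∀

    one-and-two : ∀ x y z → x + y ≤ N → z + z ≤ N → 2 * (x + y + z) ≤ 3 * N
    one-and-two x y z p q = subst₂ _≤_ (eq x y z) (eq′ N) (ℕ.+-mono-≤ (ℕ.+-mono-≤ p p) q)
      where
      eq : ∀ x y z → (x + y) + (x + y) + (z + z) ≡ 2 * (x + y + z)
      eq = solve-∀
      eq′ : ∀ x → x + x + x ≡ 3 * x
      eq′ = solve-∀

    ≤5⇒≤6 : ∀ x y → x + x ≤ N → y + y ≤ N → 5 * (0 + x + y) ≤ 6 * N
    ≤5⇒≤6 x y p q = ℕ.*-cancelˡ-≤ 2 (ℕ.≤-trans
      (subst₂ _≤_ (eq x y) (eq′ N) (ℕ.*-monoʳ-≤ 5 (ℕ.+-mono-≤ p q)))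
      (ℕ.≤-trans (ℕ.m≤m+n (10 * N) (2 * N)) (ℕ.≤-reflexive (eq″ N))))
      where
      eq : ∀ x y → 5 * ((x + x) + (y + y)) ≡ 2 * (5 * (0 + x + y))
      eq = solve-∀
      eq′ : ∀ x → 5 * (x + x) ≡ 10 * x
      eq′ = solve-∀
      eq″ : ∀ x → 10 * x + 2 * x ≡ 2 * (6 * x)
      eq″ = solve-∀

  -- As 0 + 1 + 4 = 0, each of the three layers bounds the sum of the other two by `N`; the three
  -- bounds add up to 2S ≤ 3N.
  ¬support-014 : a₀ ≢ 0 → a₁ ≢ 0 → a₂ ≡ 0 → a₃ ≡ 0 → a₄ ≢ 0 → ⊥
  ¬support-014 n₀ n₁ z₂ z₃ n₄ = ≤⇒¬big {a₀ + a₁ + 0 + 0 + a₄}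
    (subst₂ _≤_ (eq a₀ a₁ a₄) (eq′ N)
      (ℕ.+-mono-≤ (ℕ.+-mono-≤ (pair (# 0) (# 1) n₄) (pair (# 0) (# 4) n₁)) (pair (# 1) (# 4) n₀)))
    (cong₂ (λ u v → a₀ + a₁ + u + v + a₄) (sym z₂) (sym z₃))
    where
    eq : ∀ x y z → (x + y) + (x + z) + (y + z) ≡ 2 * (x + y + 0 + 0 + z)
    eq = solve-∀
    eq′ : ∀ x → x + x + x ≡ 3 * x
    eq′ = solve-∀

  -- Layer 2 does all the work: 1 + 2 + 2 = 0 gives `a₁ + a₂ ≤ N`, and 4 + 4 + 2 = 0 gives
  -- `2 a₄ ≤ N`. Both bounds can be almost attained together, as `extremal` shows.
  ¬support-124 : a₀ ≡ 0 → a₁ ≢ 0 → a₂ ≢ 0 → a₃ ≡ 0 → a₄ ≢ 0 → ⊥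
  ¬support-124 z₀ n₁ n₂ z₃ n₄ = ≤⇒¬big (one-and-two a₁ a₂ a₄ (pair (# 1) (# 2) n₂) (pair (# 4) (# 4) n₂))
    (trans (eq a₁ a₂ a₄) (cong₂ (λ u v → u + a₁ + a₂ + v + a₄) (sym z₀) (sym z₃)))
    where
    eq : ∀ x y z → x + y + z ≡ 0 + x + y + 0 + z
    eq = solve-∀

  ¬support-012 : a₀ ≢ 0 → a₁ ≢ 0 → a₂ ≢ 0 → a₃ ≡ 0 → a₄ ≡ 0 → ⊥
  ¬support-012 n₀ n₁ n₂ z₃ z₄ = ≤⇒¬big (one-and-two a₁ a₂ a₀ (pair (# 1) (# 2) n₂) (pair (# 0) (# 0) n₀))
    (trans (eq a₁ a₂ a₀) (cong₂ (λ u v → a₀ + a₁ + a₂ + u + v) (sym z₃) (sym z₄)))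
    where
    eq : ∀ x y z → x + y + z ≡ z + x + y + 0 + 0
    eq = solve-∀

  ¬support-0123 : a₀ ≢ 0 → a₁ ≢ 0 → a₂ ≢ 0 → a₃ ≢ 0 → a₄ ≡ 0 → ⊥
  ¬support-0123 n₀ n₁ n₂ n₃ z₄ = uncorrelated (subst (Correlated N a₀ a₁ a₂ a₃) (sym z₄)
    (correlated-gap {N} {a₀} {a₁} {a₂} {a₃}
      (subst (λ u → 3 * N ≤ 2 * (a₀ + a₁ + a₂ + a₃ + u)) z₄ (ℕ.<⇒≤ big))
      (5a₀≤2N n₀) (triple (# 1) (# 1) n₁ n₁ n₃) (triple (# 0) (# 2) n₀ n₂ n₃) (triple (# 2) (# 2) n₂ n₂ n₁)))

  ¬support-1234 : a₁ ≢ 0 → a₂ ≢ 0 → a₃ ≢ 0 → a₄ ≢ 0 → ⊥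
  ¬support-1234 n₁ n₂ n₃ n₄ = uncorrelated (correlated-balanced {N} {a₀} {a₁} {a₂} {a₃} {a₄} (ℕ.<⇒≤ big)
    e (2*≤ a₁ h₁) (2*≤ a₂ h₂) (2*≤ a₃ h₃) (2*≤ a₄ h₄) l₁ l₂
    (triple (# 1) (# 1) n₁ n₁ n₃) (triple (# 2) (# 2) n₂ n₂ n₁)
    (triple (# 3) (# 3) n₃ n₃ n₄) (triple (# 4) (# 4) n₄ n₄ n₂))
    where
    h₁ : a₁ + a₁ ≤ N
    h₁ = pair (# 1) (# 1) n₃
    h₂ : a₂ + a₂ ≤ N
    h₂ = pair (# 2) (# 2) n₁
    h₃ : a₃ + a₃ ≤ N
    h₃ = pair (# 3) (# 3) n₄
    h₄ : a₄ + a₄ ≤ N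
    h₄ = pair (# 4) (# 4) n₂
    e : 5 * a₀ ≤ 2 * N
    e with a₀ ℕ.≟ 0
    ... | yes z₀ = subst (λ x → 5 * x ≤ 2 * N) (sym z₀) z≤n
    ... | no  n₀ = 5a₀≤2N n₀
    l₁ : 5 * (a₀ + a₁ + a₄) ≤ 6 * N
    l₁ with a₀ ℕ.≟ 0
    ... | yes z₀ = subst (λ x → 5 * (x + a₁ + a₄) ≤ 6 * N) (sym z₀) (≤5⇒≤6 a₁ a₄ h₁ h₄)
    ... | no  n₀ = triple (# 0) (# 1) n₀ n₁ n₄
    l₂ : 5 * (a₀ + a₂ + a₃) ≤ 6 * N
    l₂ with a₀ ℕ.≟ 0
    ... | yes z₀ = subst (λ x → 5 * (x + a₂ + a₃) ≤ 6 * N) (sym z₀) (≤5⇒≤6 a₂ a₃ h₂ h₃)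
    ... | no  n₀ = triple (# 0) (# 2) n₀ n₂ n₃

TwoOf : (Fin 5 → Set) → Set
TwoOf P = ∃ λ i → ∃ λ j → ∀ k → P k → k ≡ i ⊎ k ≡ j

complement? : ∀ (p q r : Fin 5) → Dec (∃ λ i → ∃ λ j → ∀ k → k ≢ p × k ≢ q × k ≢ r → k ≡ i ⊎ k ≡ j)
complement? p q r = any? λ i → any? λ j → all? λ k →
  (¬? (k ≟F p) ×-dec ¬? (k ≟F q) ×-dec ¬? (k ≟F r)) →-dec (k ≟F i ⊎-dec k ≟F j)

three-zeros : ∀ {a : Fin 5 → ℕ} (p q r : Fin 5) {_ : True (complement? p q r)} →
              a p ≡ 0 → a q ≡ 0 → a r ≡ 0 → TwoOf λ k → a k ≢ 0
three-zeros p q r {h} zp zq zr with toWitness {a? = complement? p q r} h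
... | i , j , cover = i , j , λ k n → cover k ((λ { refl → n zp }) , (λ { refl → n zq }) , (λ { refl → n zr }))

opaque
  -- Up to dilation, a support with at least three elements is {0,1,4}, {0,1,2}, {1,2,4} or
  -- {0,1,2,3}, or else it contains 1, 2, 3 and 4.
  support≤2 : ∀ {N a} → Config N a → TwoOf λ k → a k ≢ 0
  support≤2 {N} {a} c = go (a (# 0) ℕ.≟ 0) (a (# 1) ℕ.≟ 0) (a (# 2) ℕ.≟ 0) (a (# 3) ℕ.≟ 0) (a (# 4) ℕ.≟ 0)
    where
    -- The superscript is the multiplier modulo 5, not the number of doublings: three doublings
    -- multiply by 8 = 3.
    c² : Config N (a ∘ ((# 2) *₅_))
    c² = double c
    c⁴ : Config N (a ∘ ((# 2) *₅_) ∘ ((# 2) *₅_))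
    c⁴ = double c²
    c³ : Config N (a ∘ ((# 2) *₅_) ∘ ((# 2) *₅_) ∘ ((# 2) *₅_))
    c³ = double c⁴
    go : Dec (a (# 0) ≡ 0) → Dec (a (# 1) ≡ 0) → Dec (a (# 2) ≡ 0) → Dec (a (# 3) ≡ 0) → Dec (a (# 4) ≡ 0) →
         TwoOf λ k → a k ≢ 0
    go (yes z₀) (yes z₁) (yes z₂) _ _ = three-zeros (# 0) (# 1) (# 2) z₀ z₁ z₂
    go (yes z₀) (yes z₁) _ (yes z₃) _ = three-zeros (# 0) (# 1) (# 3) z₀ z₁ z₃
    go (yes z₀) (yes z₁) _ _ (yes z₄) = three-zeros (# 0) (# 1) (# 4) z₀ z₁ z₄
    go (yes z₀) _ (yes z₂) (yes z₃) _ = three-zeros (# 0) (# 2) (# 3) z₀ z₂ z₃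
    go (yes z₀) _ (yes z₂) _ (yes z₄) = three-zeros (# 0) (# 2) (# 4) z₀ z₂ z₄
    go (yes z₀) _ _ (yes z₃) (yes z₄) = three-zeros (# 0) (# 3) (# 4) z₀ z₃ z₄
    go _ (yes z₁) (yes z₂) (yes z₃) _ = three-zeros (# 1) (# 2) (# 3) z₁ z₂ z₃
    go _ (yes z₁) (yes z₂) _ (yes z₄) = three-zeros (# 1) (# 2) (# 4) z₁ z₂ z₄
    go _ (yes z₁) _ (yes z₃) (yes z₄) = three-zeros (# 1) (# 3) (# 4) z₁ z₃ z₄
    go _ _ (yes z₂) (yes z₃) (yes z₄) = three-zeros (# 2) (# 3) (# 4) z₂ z₃ z₄
    go (yes z₀) (yes z₁) (no n₂) (no n₃) (no n₄) = ⊥-elim (¬support-124 c² z₀ n₂ n₄ z₁ n₃)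
    go (yes z₀) (no n₁) (yes z₂) (no n₃) (no n₄) = ⊥-elim (¬support-124 c⁴ z₀ n₄ n₃ z₂ n₁)
    go (yes z₀) (no n₁) (no n₂) (yes z₃) (no n₄) = ⊥-elim (¬support-124 c z₀ n₁ n₂ z₃ n₄)
    go (yes z₀) (no n₁) (no n₂) (no n₃) (yes z₄) = ⊥-elim (¬support-124 c³ z₀ n₃ n₁ z₄ n₂)
    go (no n₀) (yes z₁) (yes z₂) (no n₃) (no n₄) = ⊥-elim (¬support-012 c⁴ n₀ n₄ n₃ z₂ z₁)
    go (no n₀) (yes z₁) (no n₂) (yes z₃) (no n₄) = ⊥-elim (¬support-012 c² n₀ n₂ n₄ z₁ z₃)
    go (no n₀) (yes z₁) (no n₂) (no n₃) (yes z₄) = ⊥-elim (¬support-014 c² n₀ n₂ z₄ z₁ n₃)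
    go (no n₀) (no n₁) (yes z₂) (yes z₃) (no n₄) = ⊥-elim (¬support-014 c n₀ n₁ z₂ z₃ n₄)
    go (no n₀) (no n₁) (yes z₂) (no n₃) (yes z₄) = ⊥-elim (¬support-012 c³ n₀ n₃ n₁ z₄ z₂)
    go (no n₀) (no n₁) (no n₂) (yes z₃) (yes z₄) = ⊥-elim (¬support-012 c n₀ n₁ n₂ z₃ z₄)
    go (no n₀) (yes z₁) (no n₂) (no n₃) (no n₄) = ⊥-elim (¬support-0123 c⁴ n₀ n₄ n₃ n₂ z₁)
    go (no n₀) (no n₁) (yes z₂) (no n₃) (no n₄) = ⊥-elim (¬support-0123 c³ n₀ n₃ n₁ n₄ z₂)
    go (no n₀) (no n₁) (no n₂) (yes z₃) (no n₄) = ⊥-elim (¬support-0123 c² n₀ n₂ n₄ n₁ z₃)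
    go (no n₀) (no n₁) (no n₂) (no n₃) (yes z₄) = ⊥-elim (¬support-0123 c n₀ n₁ n₂ n₃ z₄)
    go _ (no n₁) (no n₂) (no n₃) (no n₄) = ⊥-elim (¬support-1234 c n₁ n₂ n₃ n₄)

-- Sets of density more than 3/10

InTwoLayers : ∀ {n} → Subset n → Set
InTwoLayers {n} A = ∃ λ (φ : G n) → φ ≢ 𝟎 × TwoOf λ k → ∃ λ x → x ∈ A × φ · x ≡ k

layer-config : ∀ {m} (A : Subset (suc m)) → ZeroSumFree A → 3 * 5 ^ m < 2 * size A →
               ∀ φ → φ ≢ 𝟎 → ¬ onLayers (Correlated (5 ^ m)) (layer A φ) → Config (5 ^ m) (layer A φ)
layer-config {m} A zsf big φ φ≢𝟎 uncorr = record
  { pair         = layer-pair zsf φ≢𝟎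
  ; triple       = layer-triple zsf φ≢𝟎
  ; big          = subst (λ s → 3 * 5 ^ m < 2 * s) (trans (ΣG≡Σlayers A φ) (Σ₅-expand (layer A φ))) big
  ; uncorrelated = uncorr
  }

zsf⇒twoLayers : ∀ {m} (A : Subset (suc m)) → ZeroSumFree A → 3 * 5 ^ m < 2 * size A → InTwoLayers A
zsf⇒twoLayers {m} A zsf big = φ , φ≢𝟎 , i , j , λ { k (x , x∈A , φx≡k) →
  cover k (subst (λ t → layer A φ t ≢ 0) φx≡k (∈⇒layer≢0 A φ x∈A)) }
  where
  uncorrelated : ∃ λ φ → φ ≢ 𝟎 × ¬ onLayers (Correlated (5 ^ m)) (layer A φ)
  uncorrelated = ∃uncorrelated A zsf big
  φ   = proj₁ uncorrelated
  φ≢𝟎 = proj₁ (proj₂ uncorrelated)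
  support : TwoOf λ k → layer A φ k ≢ 0
  support = support≤2 (layer-config A zsf big φ φ≢𝟎 (proj₂ (proj₂ uncorrelated)))
  i     = proj₁ support
  j     = proj₁ (proj₂ support)
  cover = proj₂ (proj₂ support)

inSumset? : ∀ {n} k (A : Subset n) g → Dec (InSumset k A g)
inSumset? zero          A g = g ≟G 𝟎
inSumset? (suc zero)    A g = A g Bool.≟ true
inSumset? (suc (suc k)) A g = anyG? λ a → (A a Bool.≟ true) ×-dec inSumset? (suc k) A (g ⊝ a)

-- In exponent 5 three times 2g is 6g = g, so translation by 2g moves the missing element `g` to
-- `𝟎`.
missing⇒zsf : ∀ {n} {A : Subset n} {g} → ¬ InSumset 3 A g → ZeroSumFree (λ x → A (x ⊕ (g ⊕ g)))
missing⇒zsf {A = A} {g} g∉3A x y z x∈ y∈ z∈ sum≡𝟎 = g∉3A (_ , x∈ , _ , y∈ , subst (_∈ A) eq z∈)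
  where
  eq : z ⊕ (g ⊕ g) ≡ (g ⊝ (x ⊕ (g ⊕ g))) ⊝ (y ⊕ (g ⊕ g))
  eq = trans (by-law (′z :+ (′w :+ ′w)) ((((′x :+ ′y) :+ ′z) :+ (′w :- (′x :+ (′w :+ ′w)))) :- (′y :+ (′w :+ ′w))) (x ∷ y ∷ z ∷ g ∷ []))
    (trans (cong (λ s → (s ⊕ (g ⊝ (x ⊕ (g ⊕ g)))) ⊝ (y ⊕ (g ⊕ g))) sum≡𝟎)
      (by-law ((:0 :+ ′x) :- ′y) (′x :- ′y) (g ⊝ (x ⊕ (g ⊕ g)) ∷ y ⊕ (g ⊕ g) ∷ [])))

opaque
  ∃missing : ∀ {n} k (A : Subset n) → ¬ SumsetIsAll k A → ∃ λ g → ¬ InSumset k A g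
  ∃missing k A ≢all with anyG? (λ g → ¬? (inSumset? k A g))
  ... | yes found = found
  ... | no none   = ⊥-elim (≢all λ g → decidable-stable (inSumset? k A g) λ g∉ → none (g , g∉))

untranslate : ∀ {n} (A : Subset n) h → InTwoLayers (λ x → A (x ⊕ h)) → InTwoLayers A
untranslate A h (φ , φ≢𝟎 , i , j , cover) = φ , φ≢𝟎 , i +₅ (φ · h) , j +₅ (φ · h) , λ { k (x , x∈A , φx≡k) →
  [ inj₁ ∘ trans (sym φx≡k) ∘ back x , inj₂ ∘ trans (sym φx≡k) ∘ back x ]′
    (cover _ (x ⊝ h , trans (cong A (cancel x)) x∈A , refl)) }
  where
  cancel : ∀ x → (x ⊝ h) ⊕ h ≡ x
  cancel x = by-law ((′x :- ′y) :+ ′y) ′x (x ∷ h ∷ [])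
  back : ∀ x {t} → φ · (x ⊝ h) ≡ t → φ · x ≡ t +₅ (φ · h)
  back x q = trans (cong (φ ·_) (sym (cancel x))) (trans (·-⊕ φ (x ⊝ h) h) (cong (_+₅ (φ · h)) q))

opaque
  inTwoLayers : ∀ {m} (A : Subset (suc m)) → ¬ SumsetIsAll 3 A → 3 * 5 ^ m < 2 * size A → InTwoLayers A
  inTwoLayers {m} A ≢all big = untranslate A (g ⊕ g) (zsf⇒twoLayers (λ x → A (x ⊕ (g ⊕ g)))
    (missing⇒zsf (proj₂ missing))
    (subst (λ s → 3 * 5 ^ m < 2 * s) (sym (ΣG-shift (𝟙 ∘ A) (g ⊕ g))) big))
    where
    missing : ∃ λ g → ¬ InSumset 3 A g
    missing = ∃missing 3 A ≢all
    g : G (suc m)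
    g = proj₁ missing

inTwoLayers⇒inTwoCosets : ∀ {n} {A : Subset n} → InTwoLayers A → InTwoCosetsOfIndex5 A
inTwoLayers⇒inTwoCosets {n} {A} (φ , φ≢𝟎 , i , j , cover) =
  H , (H-subgroup , trans (cong (5 *_) (∣∣≡ΣG H)) (5*fibre≡ φ zero φ≢𝟎)) ,
  rep i , rep j , λ x x∈A → [ inj₁ ∘ coset x∈A , inj₂ ∘ coset x∈A ]′ (cover _ (x , x∈A , refl))
  where
  H : Subset n
  H x = does (φ · x ≟F zero)
  H⇒ : ∀ {x} → x ∈ H → φ · x ≡ zero
  H⇒ {x} = does⇒ (φ · x ≟F zero)
  H-subgroup : IsSubgroup H
  H-subgroup = record
    { has-zero   = in-fibre φ (trans (·-comm φ 𝟎) (𝟎· φ))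
    ; closed-+   = λ x y x∈ y∈ → in-fibre φ (trans (·-⊕ φ x y) (cong₂ _+₅_ (H⇒ x∈) (H⇒ y∈)))
    ; closed-neg = λ x x∈ → in-fibre φ (trans (·-⊖ φ x) (cong -₅_ (H⇒ x∈)))
    }
  inLayer? : ∀ t → Dec (∃ λ x → x ∈ A × φ · x ≡ t)
  inLayer? t = anyG? λ x → (A x Bool.≟ true) ×-dec (φ · x ≟F t)
  rep : Fin 5 → G n
  rep t with inLayer? t
  ... | yes (x , _) = x
  -- An arbitrary value: no point of `A` lies in an empty layer, so this representative is never
  -- compared with one.
  ... | no _        = 𝟎
  coset : ∀ {x t} → x ∈ A → φ · x ≡ t → (x ⊝ rep t) ∈ H
  coset {x} {t} x∈A refl with inLayer? (φ · x)
  ... | yes (y , _ , φy) = in-fibre φ (trans (·-⊝ φ x y) (trans (cong (λ s → (φ · x) +₅ (-₅ s)) φy)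
                             (by-law₅ (′x :- ′x) :0 (φ · x ∷ []))))
  ... | no none = ⊥-elim (none (x , x∈A , refl))

-- Maximal sets inside two layers are periodic

opaque
  -- The only sums are 3i, 2i + j, i + 2j and 3j, at most four of the five residues.
  avoided : ∀ (i j : Fin 5) → ∃ λ (t : Fin 5) → ∀ p q r → p ≡ i ⊎ p ≡ j → q ≡ i ⊎ q ≡ j → r ≡ i ⊎ r ≡ j →
            (p +₅ q) +₅ r ≢ t
  avoided = toWitness {a? = all? λ i → all? λ j → any? λ t → all? λ p → all? λ q → all? λ r →
    (p ≟F i ⊎-dec p ≟F j) →-dec (q ≟F i ⊎-dec q ≟F j) →-dec (r ≟F i ⊎-dec r ≟F j) →-dec
    ¬? ((p +₅ q) +₅ r ≟F t)} _

5^≢0 : ∀ m → 5 ^ m ≢ 0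
5^≢0 m h with 5 ^ m | ℕ.m^n>0 5 m
5^≢0 m refl | .0 | ()

fibre-inhabited : ∀ {m} {φ : G (suc m)} → φ ≢ 𝟎 → ∀ t → ∃ λ x → φ · x ≡ t
fibre-inhabited {m} {φ} φ≢𝟎 t with size≢0⇒∃ (λ x → does (φ · x ≟F t)) (5^≢0 m ∘ trans (sym (fibre≡ φ t φ≢𝟎)))
... | x , x∈ = x , does⇒ (φ · x ≟F t) x∈

-- Dimension at least 2 matters here: the kernel has 5ⁿ⁻¹ ≥ 5 elements. In dimension 1 it is
-- trivial, which is why two full layers can be aperiodic there.
kernel-nontrivial : ∀ {m} {φ : G (suc (suc m))} → φ ≢ 𝟎 → ∃ λ h → φ · h ≡ zero × h ≢ 𝟎
kernel-nontrivial {m} {φ} φ≢𝟎 with anyG? (λ h → (φ · h ≟F zero) ×-dec ¬? (h ≟G 𝟎))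
... | yes found = found
... | no none = ⊥-elim (ℕ.<⇒≱ (ℕ.*-monoʳ-≤ 5 {1} {5 ^ m} (ℕ.m^n>0 5 m)) (begin
  5 * 5 ^ m                     ≡⟨ fibre≡ φ zero φ≢𝟎 ⟨
  ΣG (λ x → δ₅ (φ · x) zero)    ≤⟨ ΣG-mono pointwise ⟩
  ΣG (λ x → δ 𝟎 x * 1)          ≡⟨ ΣG-δ 𝟎 (λ _ → 1) ⟩
  1                             ≤⟨ s≤s z≤n ⟩
  4                             ∎))
  where
  open ℕ.≤-Reasoning
  pointwise : ∀ x → δ₅ (φ · x) zero ≤ δ 𝟎 x * 1
  pointwise x with 𝟎 ≟G x
  ... | yes _  = 𝟙-mono {does (φ · x ≟F zero)} {true} λ _ → refl
  ... | no 𝟎≢x = 𝟙-mono {does (φ · x ≟F zero)} {false} λ h →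
          ⊥-elim (none (x , does⇒ (φ · x ≟F zero) h , 𝟎≢x ∘ sym))

∪-elim : ∀ {n} {A : Subset n} {g x} → x ∈ (A ∪｛ g ｝) → x ∈ A ⊎ x ≡ g
∪-elim {A = A} {g} {x} h with A x
... | true  = inj₁ refl
... | false = inj₂ (does⇒ (x ≟G g) h)

∪-inˡ : ∀ {n} {A : Subset n} {g x} → x ∈ A → x ∈ (A ∪｛ g ｝)
∪-inˡ x∈A rewrite x∈A = refl

∪-inʳ : ∀ {n} {A : Subset n} g → g ∈ (A ∪｛ g ｝)
∪-inʳ {A = A} g = trans (cong (A g ∨_) (dec-true (g ≟G g) refl)) (Bool.∨-zeroʳ (A g))

module _ {m : ℕ} {A : Subset (suc m)} (maximal : ∀ g → A g ≡ false → SumsetIsAll 3 (A ∪｛ g ｝))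
         {φ : G (suc m)} (φ≢𝟎 : φ ≢ 𝟎) {i j : Fin 5}
         (cover : ∀ k → (∃ λ x → x ∈ A × φ · x ≡ k) → k ≡ i ⊎ k ≡ j) where

  -- Adding a missing point of the two layers would keep the set inside them, so its threefold
  -- sumset would still miss the whole fibre over the avoided residue, against maximality.
  layers-full : ∀ x → φ · x ≡ i ⊎ φ · x ≡ j → x ∈ A
  layers-full x φx∈ with A x in x∉A
  ... | true  = refl
  ... | false = ⊥-elim (t-avoided _ _ _ (in-layer a∈) (in-layer b∈) (in-layer c∈) sum)
    where
    t = proj₁ (avoided i j)
    t-avoided = proj₂ (avoided i j)
    g = proj₁ (fibre-inhabited φ≢𝟎 t)
    φg≡t = proj₂ (fibre-inhabited φ≢𝟎 t)
    g∈ : InSumset 3 (A ∪｛ x ｝) g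
    g∈ = maximal x x∉A g
    a = proj₁ g∈
    a∈ = proj₁ (proj₂ g∈)
    b = proj₁ (proj₂ (proj₂ g∈))
    b∈ = proj₁ (proj₂ (proj₂ (proj₂ g∈)))
    c∈ = proj₂ (proj₂ (proj₂ (proj₂ g∈)))
    in-layer : ∀ {y} → y ∈ (A ∪｛ x ｝) → φ · y ≡ i ⊎ φ · y ≡ j
    in-layer {y} y∈ with ∪-elim {A = A} {x} y∈
    ... | inj₁ y∈A  = cover _ (y , y∈A , refl)
    ... | inj₂ refl = φx∈
    sum : ((φ · a) +₅ (φ · b)) +₅ (φ · ((g ⊝ a) ⊝ b)) ≡ t
    sum = trans (cong (_+₅ (φ · ((g ⊝ a) ⊝ b))) (sym (·-⊕ φ a b))) (trans (sym (·-⊕ φ (a ⊕ b) ((g ⊝ a) ⊝ b)))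
      (trans (cong (φ ·_) (by-law ((′x :+ ′y) :+ ((′z :- ′x) :- ′y)) ′z (a ∷ b ∷ g ∷ []))) φg≡t))

  periodic : ∀ h → φ · h ≡ zero → ∀ x → A (x ⊝ h) ≡ A x
  periodic h φh x = Bool.⇔→≡ {z = true} (mk⇔
    (λ p → layers-full x (subst (λ t → t ≡ i ⊎ t ≡ j) φ-eq (cover _ (_ , p , refl))))
    (λ p → layers-full (x ⊝ h) (subst (λ t → t ≡ i ⊎ t ≡ j) (sym φ-eq) (cover _ (_ , p , refl)))))
    where
    φ-eq : φ · (x ⊝ h) ≡ φ · x
    φ-eq = trans (·-⊝ φ x h) (trans (cong (λ s → (φ · x) +₅ (-₅ s)) φh) (by-law₅ (′x :- :0) ′x (φ · x ∷ [])))

admissible⇒small : ∀ {m} (A : Subset (suc (suc m))) → Admissible 3 (suc (suc m)) A →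
                   ¬ (3 * 5 ^ suc m < 2 * size A)
admissible⇒small A (aperiodic , ≢all , maximal) big = step (inTwoLayers A ≢all big)
  where
  step : InTwoLayers A → ⊥
  step (φ , φ≢𝟎 , i , j , cover) with kernel-nontrivial φ≢𝟎
  ... | h , φh , h≢𝟎 = h≢𝟎 (aperiodic h (periodic maximal φ≢𝟎 cover h φh))

-- Serves dimension 1, where layers are single points: there a set of three elements already exceeds
-- the density threshold, and this bound of 2 refutes it.
inTwoLayers⇒size≤ : ∀ {m} {A : Subset (suc m)} → InTwoLayers A → size A ≤ 5 ^ m + 5 ^ m
inTwoLayers⇒size≤ {m} {A} (φ , φ≢𝟎 , i , j , cover) = begin
  size A                                                ≤⟨ ΣG-mono pointwise ⟩
  ΣG (λ x → δ₅ (φ · x) i + δ₅ (φ · x) j)                ≡⟨ ΣG-+ (λ x → δ₅ (φ · x) i) (λ x → δ₅ (φ · x) j) ⟩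
  ΣG (λ x → δ₅ (φ · x) i) + ΣG (λ x → δ₅ (φ · x) j)     ≡⟨ cong₂ _+_ (fibre≡ φ i φ≢𝟎) (fibre≡ φ j φ≢𝟎) ⟩
  5 ^ m + 5 ^ m                                         ∎
  where
  open ℕ.≤-Reasoning
  pointwise : ∀ x → 𝟙 (A x) ≤ δ₅ (φ · x) i + δ₅ (φ · x) j
  pointwise x with A x in x∈A
  ... | false = z≤n
  ... | true with cover _ (x , x∈A , refl)
  ...   | inj₁ φx = ℕ.≤-trans (ℕ.≤-reflexive (cong 𝟙 (sym (in-fibre φ φx)))) (ℕ.m≤m+n _ _)
  ...   | inj₂ φx = ℕ.≤-trans (ℕ.≤-reflexive (cong 𝟙 (sym (in-fibre φ φx)))) (ℕ.m≤n+m _ _)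

-- The extremal sets

𝒩₃[ℤ₅] : IsN 3 1 2
𝒩₃[ℤ₅] = upper , inj₂ (A , (aperiodic , ≢all , maximal) , refl)
  where
  upper : ∀ A → Admissible 3 1 A → ∣ A ∣ ≤ 2
  upper A (_ , ≢all , _) with ∣ A ∣ ≤? 2
  ... | yes h = h
  ... | no  h = subst (_≤ 2) (sym (∣∣≡ΣG A)) (inTwoLayers⇒size≤ (inTwoLayers A ≢all
                  (ℕ.≤-trans (s≤s (s≤s (s≤s (s≤s z≤n)))) (ℕ.*-monoʳ-≤ 2 (subst (3 ≤_) (∣∣≡ΣG A) (ℕ.≰⇒> h))))))
  -- The set {0, 1}, whose threefold sumset {0, 1, 2, 3} misses only 4.
  A : Subset 1
  A (x ∷ []) = does (x ≟F (# 0)) ∨ does (x ≟F (# 1))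
  aperiodic : Aperiodic A
  aperiodic = toWitness {a? = allG? λ g → (allG? λ x → A (x ⊝ g) Bool.≟ A x) →-dec (g ≟G 𝟎)} _
  ≢all : ¬ SumsetIsAll 3 A
  ≢all = toWitness {a? = ¬? (allG? (inSumset? 3 A))} _
  maximal : ∀ g → A g ≡ false → SumsetIsAll 3 (A ∪｛ g ｝)
  maximal = toWitness {a? = allG? λ g → (A g Bool.≟ false) →-dec allG? (inSumset? 3 (A ∪｛ g ｝))} _

-- Exactly one of x and ⊖ x is positive when x ≢ 𝟎.
positive : ∀ {m} → Subset m
positive []             = false
positive (zero ∷ x)     = positive x
positive (suc zero ∷ x) = true
positive (suc (suc zero) ∷ x) = true
positive (suc (suc (suc _)) ∷ x) = false

positive-antisym : ∀ {m} (x : G m) → x ∈ positive → (⊖ x) ∈ positive → ⊥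
positive-antisym (zero ∷ x) p q = positive-antisym x p q
positive-antisym (suc zero ∷ x) p ()
positive-antisym (suc (suc zero) ∷ x) p ()

positive-total : ∀ {m} (x : G m) → x ≢ 𝟎 → positive x ≡ false → (⊖ x) ∈ positive
positive-total [] h _ = ⊥-elim (h refl)
positive-total (zero ∷ x) h p = positive-total x (h ∘ cong (zero ∷_)) p
positive-total (suc (suc (suc zero)) ∷ x) h p = refl
positive-total (suc (suc (suc (suc zero))) ∷ x) h p = refl

¬positive-𝟎 : ∀ {m} → positive {m} 𝟎 ≡ false
¬positive-𝟎 {zero}  = refl
¬positive-𝟎 {suc m} = ¬positive-𝟎 {m}

size-positive : ∀ m → 5 ^ m ≡ 2 * size (positive {m}) + 1
size-positive zero    = cong (λ s → 2 * s + 1) (sym (ΣG-[] (𝟙 ∘ positive)))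
size-positive (suc m) = begin
  5 * 5 ^ m                       ≡⟨ eq (5 ^ m) ⟩
  5 ^ m + 2 * (2 * 5 ^ m)         ≡⟨ cong (_+ 2 * (2 * 5 ^ m)) (size-positive m) ⟩
  2 * p + 1 + 2 * (2 * 5 ^ m)     ≡⟨ eq′ p (5 ^ m) ⟩
  2 * (p + 5 ^ m * 1 + 5 ^ m * 1 + 5 ^ m * 0 + 5 ^ m * 0) + 1
    ≡⟨ cong (λ s → 2 * s + 1) (cong₂ _+_ (cong₂ _+_ (cong₂ _+_ (cong (p +_) (ΣG-const m 1)) (ΣG-const m 1)) (ΣG-const m 0)) (ΣG-const m 0)) ⟨
  2 * (p + ΣG {m} (λ _ → 1) + ΣG {m} (λ _ → 1) + ΣG {m} (λ _ → 0) + ΣG {m} (λ _ → 0)) + 1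
    ≡⟨ cong (λ s → 2 * s + 1) (trans (ΣG-∷ (𝟙 ∘ positive)) (Σ₅-expand (λ i → ΣG λ x → 𝟙 (positive (i ∷ x))))) ⟨
  2 * size (positive {suc m}) + 1 ∎
  where
  open ≡-Reasoning
  p = size (positive {m})
  eq : ∀ a → 5 * a ≡ a + 2 * (2 * a)
  eq = solve-∀
  eq′ : ∀ p a → 2 * p + 1 + 2 * (2 * a) ≡ 2 * (p + a * 1 + a * 1 + a * 0 + a * 0) + 1
  eq′ = solve-∀

-- Built to make both bounds of the support {1,2,4} tight. The only zero-sum index triples there are
-- 1 + 2 + 2 and 2 + 4 + 4, so a single point over 2, placed at `𝟎`, forbids just `𝟎` over 1 and
-- opposite pairs over 4. Taking half of the nonzero elements over 4 is then best possible.
extremal : ∀ {m} → Subset (suc m)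
extremal (zero ∷ y)                         = false
extremal (suc zero ∷ y)                     = not (does (y ≟G 𝟎))
extremal (suc (suc zero) ∷ y)               = does (y ≟G 𝟎)
extremal (suc (suc (suc zero)) ∷ y)         = false
extremal (suc (suc (suc (suc zero))) ∷ y)   = positive y

size-extremal : ∀ m → size (extremal {m}) ≡ 5 ^ m + size (positive {m})
size-extremal m = begin
  size (extremal {m})
    ≡⟨ trans (ΣG-∷ (𝟙 ∘ extremal)) (Σ₅-expand (λ i → ΣG λ x → 𝟙 (extremal (i ∷ x)))) ⟩
  ΣG {m} (λ _ → 0) + ΣG {m} (λ y → 𝟙 (not (does (y ≟G 𝟎)))) + ΣG {m} (λ y → 𝟙 (does (y ≟G 𝟎))) + ΣG {m} (λ _ → 0) + p
    ≡⟨ cong (λ s → s + ΣG {m} (λ y → 𝟙 (not (does (y ≟G 𝟎)))) + ΣG {m} (λ y → 𝟙 (does (y ≟G 𝟎))) + s + p) (ΣG-0 m) ⟩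
  ΣG {m} (λ y → 𝟙 (not (does (y ≟G 𝟎)))) + ΣG {m} (λ y → 𝟙 (does (y ≟G 𝟎))) + 0 + p
    ≡⟨ cong (_+ p) (ℕ.+-identityʳ _) ⟩
  ΣG {m} (λ y → 𝟙 (not (does (y ≟G 𝟎)))) + ΣG {m} (λ y → 𝟙 (does (y ≟G 𝟎))) + p
    ≡⟨ cong (_+ p) (ΣG-+ (λ y → 𝟙 (not (does (y ≟G 𝟎)))) (λ y → 𝟙 (does (y ≟G 𝟎)))) ⟨
  ΣG {m} (λ y → 𝟙 (not (does (y ≟G 𝟎))) + 𝟙 (does (y ≟G 𝟎))) + p
    ≡⟨ cong (_+ p) (trans (ΣG-cong λ y → not-+ (does (y ≟G 𝟎))) (trans (ΣG-const m 1) (ℕ.*-identityʳ (5 ^ m)))) ⟩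
  5 ^ m + p ∎
  where
  open ≡-Reasoning
  p = size (positive {m})
  not-+ : ∀ b → 𝟙 (not b) + 𝟙 b ≡ 1
  not-+ true  = refl
  not-+ false = refl

data InExtremal {m} : G (suc m) → Set where
  layer₁ : ∀ {y} → y ≢ 𝟎 → InExtremal (# 1 ∷ y)
  layer₂ : InExtremal (# 2 ∷ 𝟎)
  layer₄ : ∀ {y} → y ∈ positive → InExtremal (# 4 ∷ y)

extremal⇒ : ∀ {m} (x : G (suc m)) → x ∈ extremal → InExtremal x
extremal⇒ (suc zero ∷ y) h with y ≟G 𝟎
... | no y≢𝟎 = layer₁ y≢𝟎
extremal⇒ (suc (suc zero) ∷ y) h with y ≟G 𝟎
... | yes refl = layer₂
extremal⇒ (suc (suc (suc (suc zero))) ∷ y) h = layer₄ h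

⇒extremal : ∀ {m} {x : G (suc m)} → InExtremal x → x ∈ extremal
⇒extremal (layer₁ {y} y≢𝟎) = cong not (dec-false (y ≟G 𝟎) y≢𝟎)
⇒extremal {m} layer₂ = dec-true (𝟎 {m} ≟G 𝟎) refl
⇒extremal (layer₄ h) = h

extremal-zsf : ∀ {m} → ZeroSumFree (extremal {m})
extremal-zsf x y z x∈ y∈ z∈ = go (extremal⇒ x x∈) (extremal⇒ y y∈) (extremal⇒ z z∈)
  where
  opposite : ∀ {m} {u v : G m} → u ⊕ v ≡ 𝟎 → v ≡ ⊖ u
  opposite {u = u} {v} h = trans (by-law ′y (:- ′x :+ (′x :+ ′y)) (u ∷ v ∷ []))
    (trans (cong ((⊖ u) ⊕_) h) (by-law (:- ′x :+ :0) (:- ′x) (u ∷ [])))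
  ¬opposite : ∀ {m} {u v : G m} → u ∈ positive → v ∈ positive → u ⊕ v ≢ 𝟎
  ¬opposite {u = u} pu pv h = positive-antisym u pu (subst (_∈ positive) (opposite h) pv)
  go : ∀ {m} {x y z : G (suc m)} → InExtremal x → InExtremal y → InExtremal z → (x ⊕ y) ⊕ z ≢ 𝟎
  go (layer₁ {u} u≢) layer₂ layer₂ h = u≢ (trans (by-law ′x ((′x :+ :0) :+ :0) (u ∷ [])) (cong tail h))
  go layer₂ (layer₁ {u} u≢) layer₂ h = u≢ (trans (by-law ′x ((:0 :+ ′x) :+ :0) (u ∷ [])) (cong tail h))
  go layer₂ layer₂ (layer₁ {u} u≢) h = u≢ (trans (by-law ′x ((:0 :+ :0) :+ ′x) (u ∷ [])) (cong tail h))
  go (layer₄ {u} pu) (layer₄ {v} pv) layer₂ h =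
    ¬opposite pu pv (trans (by-law (′x :+ ′y) ((′x :+ ′y) :+ :0) (u ∷ v ∷ [])) (cong tail h))
  go (layer₄ {u} pu) layer₂ (layer₄ {v} pv) h =
    ¬opposite pu pv (trans (by-law (′x :+ ′y) ((′x :+ :0) :+ ′y) (u ∷ v ∷ [])) (cong tail h))
  go layer₂ (layer₄ {u} pu) (layer₄ {v} pv) h =
    ¬opposite pu pv (trans (by-law (′x :+ ′y) ((:0 :+ ′x) :+ ′y) (u ∷ v ∷ [])) (cong tail h))
  go (layer₁ _) (layer₁ _) (layer₁ _) ()
  go (layer₁ _) (layer₁ _) layer₂ ()
  go (layer₁ _) (layer₁ _) (layer₄ _) ()
  go (layer₁ _) layer₂ (layer₁ _) ()
  go (layer₁ _) layer₂ (layer₄ _) ()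
  go (layer₁ _) (layer₄ _) (layer₁ _) ()
  go (layer₁ _) (layer₄ _) layer₂ ()
  go (layer₁ _) (layer₄ _) (layer₄ _) ()
  go layer₂ (layer₁ _) (layer₁ _) ()
  go layer₂ (layer₁ _) (layer₄ _) ()
  go layer₂ layer₂ layer₂ ()
  go layer₂ layer₂ (layer₄ _) ()
  go layer₂ (layer₄ _) (layer₁ _) ()
  go layer₂ (layer₄ _) layer₂ ()
  go (layer₄ _) (layer₁ _) (layer₁ _) ()
  go (layer₄ _) (layer₁ _) layer₂ ()
  go (layer₄ _) (layer₁ _) (layer₄ _) ()
  go (layer₄ _) layer₂ (layer₁ _) ()
  go (layer₄ _) layer₂ layer₂ ()
  go (layer₄ _) (layer₄ _) (layer₁ _) ()
  go (layer₄ _) (layer₄ _) (layer₄ _) ()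

data Extended {m} (g : G (suc m)) : G (suc m) → Set where
  old : ∀ {x} → InExtremal x → Extended g x
  new : Extended g g

⇒extended : ∀ {m} {g x : G (suc m)} → Extended g x → x ∈ (extremal ∪｛ g ｝)
⇒extended {g = g} {x} (old h) = ∪-inˡ {A = extremal} {g} {x} (⇒extremal h)
⇒extended {g = g} new         = ∪-inʳ {A = extremal} g

extremal-≢all : ∀ {m} → ¬ SumsetIsAll 3 (extremal {m})
extremal-≢all all = step (all 𝟎)
  where
  step : ¬ InSumset 3 extremal 𝟎
  step (a , a∈ , b , b∈ , c∈) = extremal-zsf a b _ a∈ b∈ c∈
    (by-law ((′x :+ ′y) :+ ((:0 :- ′x) :- ′y)) :0 (a ∷ b ∷ []))

module _ {m : ℕ} where
  private
    y₁ y₂ : G (suc m)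
    y₁ = # 1 ∷ 𝟎
    y₂ = # 2 ∷ 𝟎

    positive≢𝟎 : ∀ {y : G (suc m)} → y ∈ positive → y ≢ 𝟎
    positive≢𝟎 h refl with () ← trans (sym h) (¬positive-𝟎 {suc m})

    ⊝-cancel : ∀ {n} {x y : G n} → x ⊝ y ≡ 𝟎 → x ≡ y
    ⊝-cancel {x = x} {y} h = trans (by-law ′x ((′x :- ′y) :+ ′y) (x ∷ y ∷ []))
      (trans (cong (_⊕ y) h) (by-law (:0 :+ ′x) ′x (y ∷ [])))

  -- Two positive elements suffice: `y₁` can serve as the positive summand unless the other summand
  -- would vanish, that is, unless s = y₁, and then `y₂` works. This requires the second factor to
  -- be nontrivial.
  split : ∀ (s : G (suc m)) → ∃ λ u → ∃ λ p → u ≢ 𝟎 × p ∈ positive × u ⊕ p ≡ s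
  split s with s ≟G y₁
  ... | no s≢y₁ = s ⊝ y₁ , y₁ , s≢y₁ ∘ ⊝-cancel , refl , by-law ((′x :- ′y) :+ ′y) ′x (s ∷ y₁ ∷ [])
  ... | yes refl = y₁ ⊝ y₂ , y₂ , (λ ()) , refl , by-law ((′x :- ′y) :+ ′y) ′x (y₁ ∷ y₂ ∷ [])

  -- A period with nonzero first coordinate would carry an inhabited layer onto the empty layer 0 or
  -- 3. Any other period has to fix the only point of layer 2.
  extremal-aperiodic : Aperiodic (extremal {suc m})
  extremal-aperiodic (zero ∷ h) per = cong (zero ∷_) (does⇒ (h ≟G 𝟎) (trans (sym (per (# 2 ∷ h)))
    (⇒extremal (subst (λ y → InExtremal (# 2 ∷ y)) (by-law :0 (′x :- ′x) (h ∷ [])) layer₂))))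
  extremal-aperiodic (suc zero ∷ h) per with () ← trans (sym (per (# 0 ∷ (y₁ ⊕ h))))
    (⇒extremal (subst (λ y → InExtremal (# 4 ∷ y)) (by-law ′x ((′x :+ ′y) :- ′y) (y₁ ∷ h ∷ [])) (layer₄ refl)))
  extremal-aperiodic (suc (suc zero) ∷ h) per with () ← trans (sym (per (# 3 ∷ (y₁ ⊕ h))))
    (⇒extremal (subst (λ y → InExtremal (# 1 ∷ y)) (by-law ′x ((′x :+ ′y) :- ′y) (y₁ ∷ h ∷ [])) (layer₁ λ ())))
  extremal-aperiodic (suc (suc (suc zero)) ∷ h) per with () ← trans (sym (per (# 0 ∷ h)))
    (⇒extremal (subst (λ y → InExtremal (# 2 ∷ y)) (by-law :0 (′x :- ′x) (h ∷ [])) layer₂))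
  extremal-aperiodic (suc (suc (suc (suc zero))) ∷ h) per with () ← trans (sym (per (# 0 ∷ (y₁ ⊕ h))))
    (⇒extremal (subst (λ y → InExtremal (# 1 ∷ y)) (by-law ′x ((′x :+ ′y) :- ′y) (y₁ ∷ h ∷ [])) (layer₁ λ ())))

  extremal-maximal : ∀ g → extremal {suc m} g ≡ false → SumsetIsAll 3 (extremal ∪｛ g ｝)
  extremal-maximal g g∉ = covers
    where
    A : Subset (suc (suc m))
    A = extremal ∪｛ g ｝
    sum₃ : ∀ {a b c t} → Extended g a → Extended g b → Extended g c → (a ⊕ b) ⊕ c ≡ t → InSumset 3 A t
    sum₃ {a} {b} {c} a∈ b∈ c∈ refl = a , ⇒extended a∈ , b , ⇒extended b∈ ,
      subst (_∈ A) (by-law ′z ((((′x :+ ′y) :+ ′z) :- ′x) :- ′y) (a ∷ b ∷ c ∷ [])) (⇒extended c∈)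

    cover-𝟎 : ∀ h → extremal {suc m} h ≡ false → Extended g h → InSumset 3 A 𝟎
    cover-𝟎 (zero ∷ y) _ h∈ with split (⊖ y)
    ... | u , p , u≢𝟎 , p∈ , u⊕p = sum₃ h∈ (old (layer₁ u≢𝟎)) (old (layer₄ {y = p} p∈)) (cong (zero ∷_)
          (trans (by-law ((′x :+ ′y) :+ ′z) (′x :+ (′y :+ ′z)) (y ∷ u ∷ p ∷ []))
            (trans (cong (y ⊕_) u⊕p) (by-law (′x :- ′x) :0 (y ∷ [])))))
    cover-𝟎 (suc zero ∷ y) h∉ h∈ with y ≟G 𝟎
    ... | yes refl = sum₃ h∈ (old layer₂) (old layer₂) (cong (zero ∷_) (by-law {0} ((:0 :+ :0) :+ :0) :0 []))
    cover-𝟎 (suc (suc zero) ∷ y) h∉ h∈ with y ≟G 𝟎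
    ... | no y≢𝟎 = sum₃ h∈ (old layer₂) (old (layer₁ {y = ⊖ y} λ q → y≢𝟎
          (trans (by-law ′x (:- :- ′x) (y ∷ [])) (trans (cong ⊖_ q) (by-law {0} (:- :0) :0 [])))))
          (cong (zero ∷_) (by-law ((′x :+ :0) :- ′x) :0 (y ∷ [])))
    cover-𝟎 (suc (suc (suc zero)) ∷ y) _ h∈ with split (⊖ y)
    ... | u , p , u≢𝟎 , p∈ , u⊕p = sum₃ h∈ (old (layer₁ u≢𝟎)) (old (layer₁ (positive≢𝟎 {p} p∈))) (cong (zero ∷_)
          (trans (by-law ((′x :+ ′y) :+ ′z) (′x :+ (′y :+ ′z)) (y ∷ u ∷ p ∷ []))
            (trans (cong (y ⊕_) u⊕p) (by-law (′x :- ′x) :0 (y ∷ [])))))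
    cover-𝟎 (suc (suc (suc (suc zero))) ∷ y) h∉ h∈ with y ≟G 𝟎
    -- The point (4, 𝟎) is opposite to itself within its layer, so the new point is used twice.
    ... | yes refl = sum₃ h∈ h∈ (old layer₂) (cong (zero ∷_) (by-law {0} ((:0 :+ :0) :+ :0) :0 []))
    ... | no y≢𝟎 = sum₃ h∈ (old (layer₄ {y = ⊖ y} (positive-total y y≢𝟎 h∉))) (old layer₂)
          (cong (zero ∷_) (by-law ((′x :- ′x) :+ :0) :0 (y ∷ [])))

    -- The new point is needed only for `𝟎`. Everything else is already a sum of three old points,
    -- with the layers combined as 1 + 2 + 2, 1 + 1 + 4, 1 + 2 + 4, 1 + 1 + 1 and 1 + 1 + 2 to reach
    -- 0, 1, 2, 3 and 4.
    covers : SumsetIsAll 3 A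
    covers (zero ∷ s) with s ≟G 𝟎
    ... | yes refl = cover-𝟎 g g∉ new
    ... | no s≢𝟎 = sum₃ (old (layer₁ s≢𝟎)) (old layer₂) (old layer₂)
          (cong (zero ∷_) (by-law ((′x :+ :0) :+ :0) ′x (s ∷ [])))
    covers (suc zero ∷ s) with split (s ⊝ y₁)
    ... | u , p , u≢𝟎 , p∈ , u⊕p = sum₃ (old (layer₁ u≢𝟎)) (old (layer₁ (positive≢𝟎 {p} p∈))) (old (layer₄ {y = y₁} refl))
          (cong (# 1 ∷_) (trans (cong (_⊕ y₁) u⊕p) (by-law ((′x :- ′y) :+ ′y) ′x (s ∷ y₁ ∷ []))))
    covers (suc (suc zero) ∷ s) with split s
    ... | u , p , u≢𝟎 , p∈ , u⊕p = sum₃ (old (layer₁ u≢𝟎)) (old layer₂) (old (layer₄ {y = p} p∈))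
          (cong (# 2 ∷_) (trans (by-law ((′x :+ :0) :+ ′y) (′x :+ ′y) (u ∷ p ∷ [])) u⊕p))
    covers (suc (suc (suc zero)) ∷ s) with split (s ⊝ y₁)
    ... | u , p , u≢𝟎 , p∈ , u⊕p = sum₃ (old (layer₁ u≢𝟎)) (old (layer₁ (positive≢𝟎 {p} p∈))) (old (layer₁ {y = y₁} λ ()))
          (cong (# 3 ∷_) (trans (cong (_⊕ y₁) u⊕p) (by-law ((′x :- ′y) :+ ′y) ′x (s ∷ y₁ ∷ []))))
    covers (suc (suc (suc (suc zero))) ∷ s) with split s
    ... | u , p , u≢𝟎 , p∈ , u⊕p = sum₃ (old (layer₁ u≢𝟎)) (old (layer₁ (positive≢𝟎 {p} p∈))) (old layer₂)
          (cong (# 4 ∷_) (trans (by-law ((′x :+ ′y) :+ :0) (′x :+ ′y) (u ∷ p ∷ [])) u⊕p))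

-- With 5ⁿ⁻¹ = 2p + 1 the halving is exact and the value is 3p + 1. Twice the next integer is 3 *
-- 5ⁿ⁻¹ + 1, just above the threshold, so upper bound and construction meet.
𝒩₃[ℤ₅ⁿ] : ∀ m → IsN 3 (suc (suc m)) ((3 * 5 ^ suc m ∸ 1) / 2)
𝒩₃[ℤ₅ⁿ] m = subst (IsN 3 (suc (suc m))) (sym value)
  ( (λ A admissible → ℕ.≤-pred (ℕ.≰⇒> λ large → admissible⇒small A admissible (exceeds (size A) (subst (suc (3 * p + 1) ≤_) (∣∣≡ΣG A) large))))
  , inj₂ (extremal , (extremal-aperiodic , extremal-≢all , extremal-maximal)
         , trans (∣∣≡ΣG extremal) (trans (size-extremal (suc m)) (trans (cong (_+ p) (size-positive (suc m))) (eq₁ p)))))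
  where
  p = size (positive {suc m})
  eq₁ : ∀ p → 2 * p + 1 + p ≡ 3 * p + 1
  eq₁ = solve-∀
  eq₂ : ∀ p → 3 * (2 * p + 1) ≡ 1 + (3 * p + 1) * 2
  eq₂ = solve-∀
  eq₃ : ∀ p → suc (suc ((3 * p + 1) * 2)) ≡ 2 * suc (3 * p + 1)
  eq₃ = solve-∀
  3*5^ : 3 * 5 ^ suc m ≡ 1 + (3 * p + 1) * 2
  3*5^ = trans (cong (3 *_) (size-positive (suc m))) (eq₂ p)
  value : (3 * 5 ^ suc m ∸ 1) / 2 ≡ 3 * p + 1
  value = trans (cong (λ s → (s ∸ 1) / 2) 3*5^) (m*n/n≡m (3 * p + 1) 2)
  exceeds : ∀ s → suc (3 * p + 1) ≤ s → 3 * 5 ^ suc m < 2 * s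
  exceeds s h = subst (_≤ 2 * s) (trans (sym (eq₃ p)) (cong suc (sym 3*5^))) (ℕ.*-monoʳ-≤ 2 h)

theorem5 : ((n : ℕ) → 1 ≤ n → (A : Subset n) → ¬ SumsetIsAll 3 A → 3 * 5 ^ (n ∸ 1) < 2 * ∣ A ∣ → InTwoCosetsOfIndex5 A)
    × IsN 3 1 2
    × ((n : ℕ) → 2 ≤ n → IsN 3 n ((3 * 5 ^ (n ∸ 1) ∸ 1) / 2))
theorem5 = stability , 𝒩₃[ℤ₅] , λ { (suc (suc m)) (s≤s (s≤s z≤n)) → 𝒩₃[ℤ₅ⁿ] m }
  where
  stability : (n : ℕ) → 1 ≤ n → (A : Subset n) → ¬ SumsetIsAll 3 A → 3 * 5 ^ (n ∸ 1) < 2 * ∣ A ∣ → InTwoCosetsOfIndex5 A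
  stability (suc m) (s≤s z≤n) A ≢all big =
    inTwoLayers⇒inTwoCosets (inTwoLayers A ≢all (subst (λ s → 3 * 5 ^ m < 2 * s) (∣∣≡ΣG A) big))
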